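{- There is a deterministic algorithm $\mathcal{A}$ with the following guarantee. Given as input a randomized $q$-query algorithm $R:\{0,1\}^n\times\{0,1\}^m\to[0,1]$ with description length $N$ and an error parameter $\varepsilon\in(0,\frac12)$, the algorithm $\mathcal{A}$ runs in time $\mathrm{poly}(N)\cdot 2^{O(q/\varepsilon)}$ and returns a deterministic $O(q/\varepsilon)$-query algorithm $D:\{0,1\}^n\to[0,1]$ satisfying $$\mathop{\mathbb{E}}_{x}\Big[\big(D(x)-\mathop{\mathbb{E}}_{r}[R(x,r)]\big)^2\Big]\le\varepsilon,$$ where $x\sim\{0,1\}^n$ and $r\sim\{0,1\}^m$ are uniformly random.
   Context: Query algorithms are represented as binary decision trees. An $n$-variable randomized decision tree (RDT) is a binary tree with two types of internal nodes: decision nodes, which branch on the value of one of the boolean variables $x_1,\dots,x_n$, and stochastic nodes, which branch on the outcome of an independent $\mathrm{Bernoulli}(\frac12)$ random bit. Leaves are labelled by values in $[0,1]$. Its query complexity is the maximum number of decision nodes on any root-to-leaf path, and its randomness complexity is the maximum number $m$ of stochastic nodes on any root-to-leaf path. The RDT computes a function $R:\{0,1\}^n\times\{0,1\}^m\to[0,1]$, where $R(x,r)$ is the label of the leaf reached on input $x$ when the stochastic nodes encountered branch according to the bits of $r$. A randomized $q$-query algorithm is an RDT of query complexity at most $q$. A deterministic decision tree (DDT), or deterministic query algorithm, is an RDT with no stochastic nodes; it computes a function $D:\{0,1\}^n\to[0,1]$. The description length is the length of the description of the tree. Constants in $O(\cdot)$ and $\mathrm{poly}(\cdot)$ are absolu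te.
   Formalization: The leaf labels of R and D in [0,1] and the error parameter ε in (0,1/2) are taken to be rational numbers rather than arbitrary real numbers. -}

module Defs where

open import Data.Bool using (Bool; true; false; if_then_else_)
open import Data.Fin using (Fin; zero; toℕ)
open import Data.Integer using (+_; ∣_∣)
open import Data.Nat as ℕ using (ℕ; zero; suc; _⊔_; _∸_; s≤s; z≤n)
open import Data.Nat.Logarithm using (⌈log₂_⌉)
open import Data.Nat.Properties using (≤-refl; m⊔n≤o⇒m≤o; m⊔n≤o⇒n≤o; ⊔-lub)
open import Data.Product using (∃-syntax; _×_; _,_)
open import Data.Rational.Unnormalised
  using (ℚᵘ; 0ℚᵘ; 1ℚᵘ; ½; _/_; ↥_; ↧ₙ_; _≤_; _+_; _*_)
open import Data.Vec using (Vec; []; _∷_; lookup)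
open import Relation.Binary.PropositionalEquality using (_≡_; refl)

-- Decision trees

-- Labels are part of the finite input of an algorithm, so they are rational.
-- They need not be in lowest terms: a label is a numerator and a denominator.
record Label : Set where
  constructor label
  field
    value   : ℚᵘ
    0≤value : 0ℚᵘ ≤ value
    value≤1 : value ≤ 1ℚᵘ

open Label public

-- The first subtree of an internal node is taken on bit 0 (`false`), the
-- second on bit 1 (`true`).
data RDT (n : ℕ) : Set where
  leaf       : Label → RDT n
  decision   : Fin n → RDT n → RDT n → RDT n
  stochastic : RDT n → RDT n → RDT n

queryComplexity : ∀ {n} → RDT n → ℕ
queryComplexity (leaf _)           = 0
queryComplexity (decision _ t₀ t₁) = suc (queryComplexity t₀ ⊔ queryComplexity t₁)
queryComplexity (stochastic t₀ t₁) = queryComplexity t₀ ⊔ queryComplexity t₁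

randomnessComplexity : ∀ {n} → RDT n → ℕ
randomnessComplexity (leaf _)           = 0
randomnessComplexity (decision _ t₀ t₁) = randomnessComplexity t₀ ⊔ randomnessComplexity t₁
randomnessComplexity (stochastic t₀ t₁) = suc (randomnessComplexity t₀ ⊔ randomnessComplexity t₁)

-- The j-th stochastic node met on a path branches on the j-th bit of r; bits
-- left over at the leaf are ignored.
run : ∀ {n m} (t : RDT n) → randomnessComplexity t ℕ.≤ m →
      Vec Bool n → Vec Bool m → Label
run (leaf v) _ x r = v
run (decision i t₀ t₁) p x r =
  if lookup x i
  then run t₁ (m⊔n≤o⇒n≤o (randomnessComplexity t₀) _ p) x r
  else run t₀ (m⊔n≤o⇒m≤o _ (randomnessComplexity t₁) p) x r
run (stochastic t₀ t₁) (s≤s p) x (b ∷ r) =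
  if b
  then run t₁ (m⊔n≤o⇒n≤o (randomnessComplexity t₀) _ p) x r
  else run t₀ (m⊔n≤o⇒m≤o _ (randomnessComplexity t₁) p) x r

⟦_⟧ : ∀ {n} (R : RDT n) → Vec Bool n → Vec Bool (randomnessComplexity R) → ℚᵘ
⟦ R ⟧ x r = value (run R ≤-refl x r)

data NoStochastic {n} : RDT n → Set where
  leaf     : ∀ {v} → NoStochastic (leaf v)
  decision : ∀ {i t₀ t₁} → NoStochastic t₀ → NoStochastic t₁ →
             NoStochastic (decision i t₀ t₁)

noStochastic⇒randomness≤0 : ∀ {n} {t : RDT n} →
                            NoStochastic t → randomnessComplexity t ℕ.≤ 0
noStochastic⇒randomness≤0 leaf           = z≤n
noStochastic⇒randomness≤0 (decision p q) =
  ⊔-lub (noStochastic⇒randomness≤0 p) (noStochastic⇒randomness≤0 q)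

record DDT (n : ℕ) : Set where
  constructor ddt
  field
    tree         : RDT n
    noStochastic : NoStochastic tree

open DDT public

⟦_⟧ᴰ : ∀ {n} → DDT n → Vec Bool n → ℚᵘ
⟦ D ⟧ᴰ x = value (run (tree D) (noStochastic⇒randomness≤0 (noStochastic D)) x [])

-- Expectation over n independent fair bits, i.e. over uniform {0,1}ⁿ.
𝔼 : ∀ {n} → (Vec Bool n → ℚᵘ) → ℚᵘ
𝔼 {zero}  f = f []
𝔼 {suc n} f = ½ * (𝔼 (λ xs → f (false ∷ xs)) + 𝔼 (λ xs → f (true ∷ xs)))

sq : ℚᵘ → ℚᵘ
sq p = p * p

-- Algorithms
--
-- An algorithm is a closed first-order program with general recursion whose
-- data are naturals and pairs.  Every step costs 1, except that a
-- multiplication is also charged the bit lengths of its operands.  Hence t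
-- units of time lengthen the longest number by at most O(t) bits, and a
-- computation of cost t on an input of b bits can be carried out by a Turing
-- machine, with pairs as pointers, in time poly(t + b).

data Val : Set where
  nat   : ℕ → Val
  ⟪_,_⟫ : Val → Val → Val

bits : ℕ → ℕ
bits k = ⌈log₂ suc k ⌉

size : Val → ℕ
size (nat k)   = suc (bits k)
size ⟪ a , b ⟫ = suc (size a ℕ.+ size b)

data Op : Set where
  add monus mul : Op

apply : Op → ℕ → ℕ → ℕ
apply add   a b = a ℕ.+ b
apply monus a b = a ∸ b
apply mul   a b = a ℕ.* b

opCost : Op → ℕ → ℕ → ℕ
opCost mul a b = suc (bits a ℕ.+ bits b)
opCost _   _ _ = 1

-- Expressions over k global unary functions and n local variables.
data Exp (k : ℕ) (n : ℕ) : Set where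
  var  : Fin n → Exp k n
  nat  : ℕ → Exp k n
  op   : Op → Exp k n → Exp k n → Exp k n
  pair : Exp k n → Exp k n → Exp k n
  let′ : Exp k n → Exp k (suc n) → Exp k n
  -- if0 e e₀ e₁: e₀ when e is the number 0, e₁ when it is a positive number.
  if0  : Exp k n → Exp k n → Exp k n → Exp k n
  -- case e e₁ e₂: e₁ when e is a number; e₂, with variables 0 and 1 bound to
  -- the components, when it is a pair.
  case : Exp k n → Exp k n → Exp k (suc (suc n)) → Exp k n
  call : Fin k → Exp k n → Exp k n

Functions : ℕ → Set
Functions k = Fin k → Exp k 1

-- F , ρ ⊢ e ⇓ v ∶ t: in the environment ρ, e evaluates to v in time t.
data _,_⊢_⇓_∶_ {k} (F : Functions k) {n} (ρ : Vec Val n) :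
     Exp k n → Val → ℕ → Set where

  var  : ∀ {i} → F , ρ ⊢ var i ⇓ lookup ρ i ∶ 1

  nat  : ∀ {a} → F , ρ ⊢ nat a ⇓ nat a ∶ 1

  op   : ∀ {o e₁ e₂ a b t₁ t₂} →
         F , ρ ⊢ e₁ ⇓ nat a ∶ t₁ →
         F , ρ ⊢ e₂ ⇓ nat b ∶ t₂ →
         F , ρ ⊢ op o e₁ e₂ ⇓ nat (apply o a b) ∶ (t₁ ℕ.+ t₂ ℕ.+ opCost o a b)

  pair : ∀ {e₁ e₂ u v t₁ t₂} →
         F , ρ ⊢ e₁ ⇓ u ∶ t₁ →
         F , ρ ⊢ e₂ ⇓ v ∶ t₂ →
         F , ρ ⊢ pair e₁ e₂ ⇓ ⟪ u , v ⟫ ∶ suc (t₁ ℕ.+ t₂)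

  let′ : ∀ {e₁ e₂ u v t₁ t₂} →
         F , ρ ⊢ e₁ ⇓ u ∶ t₁ →
         F , u ∷ ρ ⊢ e₂ ⇓ v ∶ t₂ →
         F , ρ ⊢ let′ e₁ e₂ ⇓ v ∶ suc (t₁ ℕ.+ t₂)

  if0-zero : ∀ {e e₀ e₁ v t₁ t₂} →
             F , ρ ⊢ e ⇓ nat 0 ∶ t₁ →
             F , ρ ⊢ e₀ ⇓ v ∶ t₂ →
             F , ρ ⊢ if0 e e₀ e₁ ⇓ v ∶ suc (t₁ ℕ.+ t₂)

  if0-suc : ∀ {e e₀ e₁ a v t₁ t₂} →
            F , ρ ⊢ e ⇓ nat (suc a) ∶ t₁ →
            F , ρ ⊢ e₁ ⇓ v ∶ t₂ →
            F , ρ ⊢ if0 e e₀ e₁ ⇓ v ∶ suc (t₁ ℕ.+ t₂)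

  case-nat : ∀ {e e₁ e₂ a v t₁ t₂} →
             F , ρ ⊢ e ⇓ nat a ∶ t₁ →
             F , ρ ⊢ e₁ ⇓ v ∶ t₂ →
             F , ρ ⊢ case e e₁ e₂ ⇓ v ∶ suc (t₁ ℕ.+ t₂)

  case-pair : ∀ {e e₁ e₂ a b v t₁ t₂} →
              F , ρ ⊢ e ⇓ ⟪ a , b ⟫ ∶ t₁ →
              F , a ∷ b ∷ ρ ⊢ e₂ ⇓ v ∶ t₂ →
              F , ρ ⊢ case e e₁ e₂ ⇓ v ∶ suc (t₁ ℕ.+ t₂)

  call : ∀ {f e u v t₁ t₂} →
         F , ρ ⊢ e ⇓ u ∶ t₁ →
         F , u ∷ [] ⊢ F f ⇓ v ∶ t₂ →
         F , ρ ⊢ call f e ⇓ v ∶ suc (t₁ ℕ.+ t₂)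

⇓-deterministic : ∀ {k} {F : Functions k} {n} {ρ : Vec Val n} {e u v s t} →
                  F , ρ ⊢ e ⇓ u ∶ s → F , ρ ⊢ e ⇓ v ∶ t → u ≡ v × s ≡ t
⇓-deterministic var var = refl , refl
⇓-deterministic nat nat = refl , refl
⇓-deterministic (op p q) (op p′ q′)
  with refl , refl ← ⇓-deterministic p p′
  with refl , refl ← ⇓-deterministic q q′ = refl , refl
⇓-deterministic (pair p q) (pair p′ q′)
  with refl , refl ← ⇓-deterministic p p′
  with refl , refl ← ⇓-deterministic q q′ = refl , refl
⇓-deterministic (let′ p q) (let′ p′ q′)
  with refl , refl ← ⇓-deterministic p p′
  with refl , refl ← ⇓-deterministic q q′ = refl , refl
⇓-deterministic (if0-zero p q) (if0-zero p′ q′)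
  with refl , refl ← ⇓-deterministic p p′
  with refl , refl ← ⇓-deterministic q q′ = refl , refl
⇓-deterministic (if0-zero p _) (if0-suc p′ _)
  with () , _ ← ⇓-deterministic p p′
⇓-deterministic (if0-suc p _) (if0-zero p′ _)
  with () , _ ← ⇓-deterministic p p′
⇓-deterministic (if0-suc p q) (if0-suc p′ q′)
  with refl , refl ← ⇓-deterministic p p′
  with refl , refl ← ⇓-deterministic q q′ = refl , refl
⇓-deterministic (case-nat p q) (case-nat p′ q′)
  with refl , refl ← ⇓-deterministic p p′
  with refl , refl ← ⇓-deterministic q q′ = refl , refl
⇓-deterministic (case-nat p _) (case-pair p′ _)
  with () , _ ← ⇓-deterministic p p′
⇓-deterministic (case-pair p _) (case-nat p′ _)
  with () , _ ← ⇓-deterministic p p′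
⇓-deterministic (case-pair p q) (case-pair p′ q′)
  with refl , refl ← ⇓-deterministic p p′
  with refl , refl ← ⇓-deterministic q q′ = refl , refl
⇓-deterministic (call p q) (call p′ q′)
  with refl , refl ← ⇓-deterministic p p′
  with refl , refl ← ⇓-deterministic q q′ = refl , refl

-- The entry point is function zero.
record Algorithm : Set where
  constructor algorithm
  field
    auxiliary : ℕ
    functions : Functions (suc auxiliary)

-- Evaluation builds values by reference, possibly sharing subterms, so writing
-- out the result is charged separately.
_returns_on_inTime_ : Algorithm → Val → Val → ℕ → Set
A returns v on u inTime t =
  ∃[ s ] (functions , u ∷ [] ⊢ functions zero ⇓ v ∶ s) × t ≡ s ℕ.+ size v
  where open Algorithm A

-- Inputs and outputs

-- The absolute value loses nothing on the non-negative rationals encoded here.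
encodeℚ : ℚᵘ → Val
encodeℚ p = ⟪ nat ∣ ↥ p ∣ , nat (↧ₙ p) ⟫

encode : ∀ {n} → RDT n → Val
encode (leaf v)           = ⟪ nat 0 , encodeℚ (value v) ⟫
encode (decision i t₀ t₁) = ⟪ nat 1 , ⟪ nat (toℕ i) , ⟪ encode t₀ , encode t₁ ⟫ ⟫ ⟫
encode (stochastic t₀ t₁) = ⟪ nat 2 , ⟪ encode t₀ , encode t₁ ⟫ ⟫

descriptionLength : ∀ {n} → RDT n → ℕ
descriptionLength R = size (encode R)

-- k ≤ C · q / ε, for ε > 0.
_≤_·_÷_ : ℕ → ℕ → ℕ → ℚᵘ → Set
k ≤ C · q ÷ ε = (+ k / 1) * ε ≤ (+ (C ℕ.* q) / 1)

-- t ≤ c · Nᵈ · 2^(C · q / ε); a natural exponent only rounds C · q / ε down.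
TimeBound : (c d C N q : ℕ) → ℚᵘ → ℕ → Set
TimeBound c d C N q ε t =
  ∃[ e ] (e ≤ C · q ÷ ε) × (t ℕ.≤ c ℕ.* N ℕ.^ d ℕ.* 2 ℕ.^ e)

{-# OPTIONS --safe #-}
module Submission where

-- Write f(x) = E_r[R(x,r)] and, for a path π of answered queries, let μ(π) and
-- V(π) be the mean and the variance of f on the subcube of inputs that agree
-- with π.  A decision tree whose leaves carry the labels μ(π) has squared error
-- equal to the average of V(π) over its leaves, so the task is to find few
-- queries after which f has small variance on the average.
--
-- Running R once, with its coins fixed well, is such a set of queries.  The
-- energy of a tree is the average of μ(π′)² over its leaves π′; the average
-- variance drops by exactly what the energy gains over μ(π)².  If h is the output
-- of R for random coins, then E[(f − μ)(h − μ)] = V, and h only depends on the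
-- leaf reached, so that f may be replaced by μ(π′) in this identity.  By
-- 2V(μ(π′) − μ)(h − μ) ≤ (μ(π′) − μ)² + V²(h − μ)² the energy, averaged over the
-- coins, is at least μ² + V² (`progress`).  The method of conditional
-- expectations makes the average an actual choice of coins: the algorithm
-- (`build`) walks down R and at every stochastic node moves to the subtree of
-- larger energy.  Hence one round turns variance V into at most V − V², and K
-- rounds turn any variance into at most 1/K (`build-error`).  With K = ⌈1/ε⌉ the
-- error is at most ε, and at most Kq ≤ 2q/ε queries are made (`build-queries`).
--
-- The energy is a sum over the leaves of R, each of which needs one mean, that is,
-- another sum over the leaves of R.  Numerators and denominators of these sums
-- have polynomially many bits, so each step of the walk costs poly(N, K), and the
-- output has at most 2^(Kq) leaves.  The factor poly(K) is absorbed by 2^O(Kq)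
-- (`main-time`), except if R makes no queries at all; then f is constant and no
-- round is needed.  This case is recognised in advance, since then the running
-- time must be poly(N), whatever ε is.  The length of ε is not part of N either:
-- its numerator and denominator may be so large that a single multiplication is
-- too expensive, and therefore K is found by repeated subtraction.

open import Defs

-- Rational arithmetic and uniform expectations

module Expectation where

  open import Data.Bool using (Bool; true; false)
  open import Data.Fin using (Fin; zero; suc)
  open import Data.Integer using (+_; -[1+_])
  open import Data.Nat using (zero; suc)
  open import Data.Rational.Unnormalised
  open import Data.Rational.Unnormalised.Properties
  open import Data.Rational.Unnormalised.Solver
  open import Data.Vec using (Vec; []; _∷_; _[_]≔_)
  open import Relation.Binary.PropositionalEquality using (refl)

  average : ℚᵘ → ℚᵘ → ℚᵘ
  average p q = ½ * (p + q)

  average-cong : ∀ {p q r s} → p ≃ r → q ≃ s → average p q ≃ average r s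
  average-cong p q = *-congˡ {½} (+-cong p q)

  average-mono : ∀ {p q r s} → p ≤ r → q ≤ s → average p q ≤ average r s
  average-mono p q = *-monoʳ-≤-nonNeg ½ (+-mono-≤ p q)

  average-idem : ∀ p → average p p ≃ p
  average-idem p =
    -- ½ enters as an opaque h, since ½ + ½ and 1 are equal but not identical fractions
    ≃-trans (solve 2 (λ h p → h :* (p :+ p) := (h :+ h) :* p) ≃-refl ½ p)
            (≃-trans (*-congʳ {p} {½ + ½} {1ℚᵘ} (*≡* refl)) (*-identityˡ p))
    where open +-*-Solver

  sq-nonNeg : ∀ p → 0ℚᵘ ≤ sq p
  sq-nonNeg (mkℚᵘ (+ zero)    d) = ≤-reflexive (*≡* refl)
  sq-nonNeg (mkℚᵘ (+ (suc n)) d) = nonNegative⁻¹ _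
  sq-nonNeg (mkℚᵘ -[1+ n ] d) = nonNegative⁻¹ _

  ≤-by-difference : ∀ {p q d} → 0ℚᵘ ≤ d → q - p ≃ d → p ≤ q
  ≤-by-difference 0≤d eq = 0≤q-p⇒p≤q (≤-respʳ-≃ (≃-sym eq) 0≤d)

  +-nonNeg : ∀ {p q} → 0ℚᵘ ≤ p → 0ℚᵘ ≤ q → 0ℚᵘ ≤ p + q
  +-nonNeg 0≤p 0≤q = ≤-respˡ-≃ (+-identityˡ 0ℚᵘ) (+-mono-≤ 0≤p 0≤q)

  *-nonNeg : ∀ {p q} → 0ℚᵘ ≤ p → 0ℚᵘ ≤ q → 0ℚᵘ ≤ p * q
  *-nonNeg {p} 0≤p 0≤q =
    ≤-respˡ-≃ (*-zeroʳ p) (*-monoʳ-≤-nonNeg p ⦃ nonNegative 0≤p ⦄ 0≤q)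

  -- 1 − (p − q)² is the product of 1 − p + q and 1 − q + p.
  unit-gap : ∀ (v w : Label) → 0ℚᵘ ≤ 1ℚᵘ - sq (value v - value w)
  unit-gap (label p 0≤p p≤1) (label q 0≤q q≤1) = ≤-respʳ-≃
    (solve 2 (λ p q → ((con 1ℚᵘ :- p) :+ q) :* ((con 1ℚᵘ :- q) :+ p) :=
                      con 1ℚᵘ :- (p :- q) :* (p :- q)) ≃-refl p q)
    (*-nonNeg (+-nonNeg (p≤q⇒0≤q-p p≤1) 0≤q) (+-nonNeg (p≤q⇒0≤q-p q≤1) 0≤p))
    where open +-*-Solver

  𝔼-cong : ∀ {n} {f g : Vec Bool n → ℚᵘ} → (∀ x → f x ≃ g x) → 𝔼 f ≃ 𝔼 g
  𝔼-cong {zero}  eq = eq []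
  𝔼-cong {suc n} eq = average-cong (𝔼-cong λ x → eq (false ∷ x)) (𝔼-cong λ x → eq (true ∷ x))

  𝔼-mono : ∀ {n} {f g : Vec Bool n → ℚᵘ} → (∀ x → f x ≤ g x) → 𝔼 f ≤ 𝔼 g
  𝔼-mono {zero}  le = le []
  𝔼-mono {suc n} le = average-mono (𝔼-mono λ x → le (false ∷ x)) (𝔼-mono λ x → le (true ∷ x))

  𝔼-const : ∀ {n} c → 𝔼 {n} (λ _ → c) ≃ c
  𝔼-const {zero}  c = ≃-refl
  𝔼-const {suc n} c = ≃-trans (average-cong (𝔼-const {n} c) (𝔼-const {n} c)) (average-idem c)

  𝔼-+ : ∀ {n} (f g : Vec Bool n → ℚᵘ) → 𝔼 (λ x → f x + g x) ≃ 𝔼 f + 𝔼 g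
  𝔼-+ {zero}  f g = ≃-refl
  𝔼-+ {suc n} f g =
    ≃-trans (average-cong (𝔼-+ (λ x → f (false ∷ x)) _) (𝔼-+ (λ x → f (true ∷ x)) _))
            (solve 5 (λ h a b c d → h :* ((a :+ b) :+ (c :+ d)) :=
                                    h :* (a :+ c) :+ h :* (b :+ d)) ≃-refl
                   ½ (𝔼 λ x → f (false ∷ x)) (𝔼 λ x → g (false ∷ x))
                   (𝔼 λ x → f (true ∷ x)) (𝔼 λ x → g (true ∷ x)))
    where open +-*-Solver

  𝔼-* : ∀ {n} c (f : Vec Bool n → ℚᵘ) → 𝔼 (λ x → c * f x) ≃ c * 𝔼 f
  𝔼-* {zero}  c f = ≃-refl
  𝔼-* {suc n} c f =
    ≃-trans (average-cong (𝔼-* c (λ x → f (false ∷ x))) (𝔼-* c (λ x → f (true ∷ x))))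
            (solve 4 (λ h c a b → h :* (c :* a :+ c :* b) := c :* (h :* (a :+ b))) ≃-refl
                   ½ c (𝔼 λ x → f (false ∷ x)) (𝔼 λ x → f (true ∷ x)))
    where open +-*-Solver

  𝔼-average : ∀ {n} (f g : Vec Bool n → ℚᵘ) →
              𝔼 (λ x → average (f x) (g x)) ≃ average (𝔼 f) (𝔼 g)
  𝔼-average f g = ≃-trans (𝔼-* ½ λ x → f x + g x) (*-congˡ {½} (𝔼-+ f g))

  -- Resampling one coordinate does not change the uniform distribution.
  𝔼-split : ∀ {n} (i : Fin n) (f : Vec Bool n → ℚᵘ) →
            𝔼 f ≃ average (𝔼 λ x → f (x [ i ]≔ false)) (𝔼 λ x → f (x [ i ]≔ true))
  𝔼-split {suc n} zero    f = ≃-sym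
    (average-cong (average-idem (𝔼 λ x → f (false ∷ x))) (average-idem (𝔼 λ x → f (true ∷ x))))
  𝔼-split {suc n} (suc i) f =
    ≃-trans (average-cong (𝔼-split i λ x → f (false ∷ x)) (𝔼-split i λ x → f (true ∷ x)))
            (solve 5 (λ h a b c d → h :* (h :* (a :+ b) :+ h :* (c :+ d)) :=
                                    h :* (h :* (a :+ c) :+ h :* (b :+ d))) ≃-refl
                   ½ (𝔼 λ x → f (false ∷ (x [ i ]≔ false))) (𝔼 λ x → f (false ∷ (x [ i ]≔ true)))
                   (𝔼 λ x → f (true ∷ (x [ i ]≔ false))) (𝔼 λ x → f (true ∷ (x [ i ]≔ true))))
    where open +-*-Solver

-- The derandomized tree

module Derandomization where

  open import Data.Bool using (Bool; true; false; if_then_else_)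
  open import Data.Fin using (Fin)
  open import Data.Fin.Properties using (_≟_)
  open import Data.Integer using (∣_∣)
  open import Data.List using (List; []; _∷_)
  open import Data.Maybe using (Maybe; just; nothing; _<∣>_)
  open import Data.Nat as ℕ using (ℕ; zero; suc)
  open import Data.Product using (_×_; _,_)
  open import Data.Rational.Unnormalised hiding (∣_∣)
  open import Data.Rational.Unnormalised.Properties
  open import Data.Vec using (Vec; _[_]≔_)
  open import Relation.Nullary using (does)
  open Expectation

  -- The queries answered so far, the latest first.  The oldest answer to a variable
  -- counts, in `answer` as well as in `override`: with this convention the two agree
  -- on paths that repeat a variable, and prepending a query to a path amounts to
  -- fixing one coordinate of the input before the rest of the path is applied.
  Path : ℕ → Set
  Path n = List (Fin n × Bool)

  match : ∀ {n} → Fin n × Bool → Fin n → Maybe Bool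
  match (j , b) i = if does (i ≟ j) then just b else nothing

  answer : ∀ {n} → Path n → Fin n → Maybe Bool
  answer []      i = nothing
  answer (a ∷ π) i = answer π i <∣> match a i

  override : ∀ {n} → Path n → Vec Bool n → Vec Bool n
  override []            x = x
  override ((i , b) ∷ π) x = override π (x [ i ]≔ b)

  -- A tree may query a variable that its own path, or an earlier round, has already
  -- queried.  Such a query must not split the subcube again.
  onQuery : ∀ {n} {A : Set} → Path n → Fin n → Maybe Bool →
            (A → A → A) → (Path n → A) → (Path n → A) → A
  onQuery π i nothing      join f₀ f₁ = join (f₀ ((i , false) ∷ π)) (f₁ ((i , true) ∷ π))
  onQuery π i (just false) join f₀ f₁ = f₀ π
  onQuery π i (just true)  join f₀ f₁ = f₁ π

  averageLabel : Label → Label → Label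
  averageLabel (label p 0≤p p≤1) (label q 0≤q q≤1) = label (average p q)
    (≤-respˡ-≃ (average-idem 0ℚᵘ) (average-mono 0≤p 0≤q))
    (≤-respʳ-≃ (average-idem 1ℚᵘ) (average-mono p≤1 q≤1))

  squareLabel : Label → Label
  squareLabel (label p 0≤p p≤1) = label (sq p) (sq-nonNeg p)
    (≤-trans (*-monoʳ-≤-nonNeg p ⦃ nonNegative 0≤p ⦄ p≤1) (≤-respˡ-≃ (≃-sym (*-identityʳ p)) p≤1))

  -- The average of g over the leaves reached from π by a uniformly random input and
  -- fair coins; g may depend on the path to the leaf.
  expect : ∀ {n} → (Label → Path n → Label) → RDT n → Path n → Label
  expect g (leaf v)           π = g v π
  expect g (decision i t₀ t₁) π =
    onQuery π i (answer π i) averageLabel (expect g t₀) (expect g t₁)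
  expect g (stochastic t₀ t₁) π = averageLabel (expect g t₀ π) (expect g t₁ π)

  mean : ∀ {n} → RDT n → Path n → Label
  mean = expect λ v _ → v

  squaredMean : ∀ {n} → RDT n → Label → Path n → Label
  squaredMean R _ π = squareLabel (mean R π)

  -- Var[f] on a subcube is E[f²] − μ², and averaging E[f²] over the parts of a
  -- partition of the subcube does not change it.  Thus large energy is the same as
  -- small average variance after running the tree.
  energy : ∀ {n} → RDT n → RDT n → Path n → Label
  energy R = expect (squaredMean R)

  -- Positive exactly if q exceeds p; comparing by cross multiplication.
  excess : Label → Label → ℕ
  excess p q = ∣ ↥ value q ∣ ℕ.* ↧ₙ (value p) ℕ.∸ ∣ ↥ value p ∣ ℕ.* ↧ₙ (value q)

  choose : {A : Set} → ℕ → A → A → A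
  choose zero    a b = a
  choose (suc _) a b = b

  -- `build R T k π` finishes the current round, which has reached the subtree T of R
  -- on path π, and then plays k more rounds.  A leaf of R ends a round and its label
  -- is discarded: only the queries made matter, since the best constant on the
  -- final subcube is the mean of f.
  build : ∀ {n} → RDT n → RDT n → ℕ → Path n → RDT n
  build R (leaf v)           zero    π = leaf (mean R π)
  build R (leaf v)           (suc k) π = build R R k π
  build R (decision i t₀ t₁) k       π =
    onQuery π i (answer π i) (decision i) (build R t₀ k) (build R t₁ k)
  build R (stochastic t₀ t₁) k       π =
    choose (excess (energy R t₀ π) (energy R t₁ π)) (build R t₀ k π) (build R t₁ k π)

  -- Not a count of all decision nodes: nothing below a decision node is inspected, as
  -- it only matters whether the number is zero.
  decisionsSeen : ∀ {n} → RDT n → ℕ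
  decisionsSeen (leaf _)           = 0
  decisionsSeen (decision _ _ _)   = 1
  decisionsSeen (stochastic t₀ t₁) = decisionsSeen t₀ ℕ.+ decisionsSeen t₁

  onQuery-preserves : ∀ {n} {A : Set} (P : A → Set) (π : Path n) i m {join f₀ f₁} →
                      (∀ {a b} → P a → P b → P (join a b)) →
                      (∀ π → P (f₀ π)) → (∀ π → P (f₁ π)) → P (onQuery π i m join f₀ f₁)
  onQuery-preserves P π i nothing      j p₀ p₁ = j (p₀ _) (p₁ _)
  onQuery-preserves P π i (just false) j p₀ p₁ = p₀ _
  onQuery-preserves P π i (just true)  j p₀ p₁ = p₁ _

  choose-preserves : {A : Set} (P : A → Set) (m : ℕ) {a b : A} → P a → P b → P (choose m a b)
  choose-preserves P zero    p q = p
  choose-preserves P (suc _) p q = q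

  build-noStochastic : ∀ {n} (R T : RDT n) k π → NoStochastic (build R T k π)
  build-noStochastic R (leaf v)           zero    π = leaf
  build-noStochastic R (leaf v)           (suc k) π = build-noStochastic R R k π
  build-noStochastic R (decision i t₀ t₁) k       π =
    onQuery-preserves NoStochastic π i (answer π i) decision
      (build-noStochastic R t₀ k) (build-noStochastic R t₁ k)
  build-noStochastic R (stochastic t₀ t₁) k       π =
    choose-preserves NoStochastic (excess (energy R t₀ π) (energy R t₁ π))
      (build-noStochastic R t₀ k π) (build-noStochastic R t₁ k π)

-- Error of the derandomized tree

module Accuracy where

  open import Data.Bool using (Bool; true; false; if_then_else_)
  open import Data.Fin.Properties using (_≟_)
  open import Data.Integer as ℤ using (+_; ∣_∣; +≤+)
  import Data.Integer.Properties as ℤ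
  open import Data.List using ([]; _∷_)
  open import Data.Maybe using (just; nothing)
  open import Data.Nat as ℕ using (ℕ; zero; suc; s≤s)
  import Data.Nat.Properties as ℕ
  open import Data.Product using (_,_)
  open import Data.Rational.Unnormalised hiding (∣_∣)
  open import Data.Rational.Unnormalised.Properties
  open import Data.Rational.Unnormalised.Solver
  open +-*-Solver using (solve; _:+_; _:*_; _:-_; :-_; _:=_; con)
  open import Data.Vec using (Vec; lookup; _[_]≔_)
  open import Data.Vec.Properties using (lookup∘update; lookup∘update′)
  open import Relation.Binary.PropositionalEquality using (_≡_; refl; sym; trans; cong; subst; subst₂)
  open import Relation.Nullary using (yes; no)
  open Expectation
  open Derandomization

  sem : ∀ {n} → RDT n → Vec Bool n → ℚᵘ
  sem (leaf v)           x = value v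
  sem (decision i t₀ t₁) x = if lookup x i then sem t₁ x else sem t₀ x
  sem (stochastic t₀ t₁) x = average (sem t₀ x) (sem t₁ x)

  -- Every stochastic node on a path consumes its own bit, so the expectation over
  -- the random string can be taken node by node.  For m = 0 this also evaluates a
  -- deterministic tree.
  𝔼-run : ∀ {n m} (t : RDT n) (p : randomnessComplexity t ℕ.≤ m) x →
          𝔼 (λ r → value (run t p x r)) ≃ sem t x
  𝔼-run {m = m} (leaf v) p x = 𝔼-const {m} (value v)
  𝔼-run {m = m} (decision i t₀ t₁) p x with lookup x i
  ... | false = 𝔼-run {m = m} t₀ (ℕ.m⊔n≤o⇒m≤o _ (randomnessComplexity t₁) p) x
  ... | true  = 𝔼-run {m = m} t₁ (ℕ.m⊔n≤o⇒n≤o (randomnessComplexity t₀) _ p) x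
  𝔼-run {m = suc m} (stochastic t₀ t₁) (s≤s p) x = average-cong
    (𝔼-run {m = m} t₀ (ℕ.m⊔n≤o⇒m≤o _ (randomnessComplexity t₁) p) x)
    (𝔼-run {m = m} t₁ (ℕ.m⊔n≤o⇒n≤o (randomnessComplexity t₀) _ p) x)

  -- Conditional expectation given the answers on π: overriding a uniform input is
  -- uniform on the subcube of π.
  𝔼[_∣_] : ∀ {n} → (Vec Bool n → ℚᵘ) → Path n → ℚᵘ
  𝔼[ f ∣ π ] = 𝔼 λ x → f (override π x)

  lookup-fresh : ∀ {n} (π : Path n) i x → answer π i ≡ nothing →
                 lookup (override π x) i ≡ lookup x i
  lookup-fresh []            i x eq = refl
  lookup-fresh ((j , b) ∷ π) i x eq with answer π i in eqπ
  ... | nothing with i ≟ j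
  ...   | no i≢j = trans (lookup-fresh π i _ eqπ) (lookup∘update′ i≢j x b)

  lookup-answer : ∀ {n} (π : Path n) i x {b} → answer π i ≡ just b →
                  lookup (override π x) i ≡ b
  lookup-answer ((j , c) ∷ π) i x eq with answer π i in eqπ
  lookup-answer ((j , c) ∷ π) i x refl | just _ = lookup-answer π i _ eqπ
  lookup-answer ((j , c) ∷ π) i x eq   | nothing with i ≟ j
  lookup-answer ((j , c) ∷ π) i x refl | nothing | yes refl =
    trans (lookup-fresh π i _ eqπ) (lookup∘update i x c)

  -- The integrand Φ is an arbitrary function of the output of the tree and of the
  -- input, as later both affine functions and squared errors are needed.
  sem-asked : ∀ {n} (Φ : ℚᵘ → Vec Bool n → ℚᵘ) (π : Path n) i (t₀ t₁ : RDT n) b →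
              answer π i ≡ just b → ∀ x → let y = override π x in
              Φ (sem (decision i t₀ t₁) y) y ≡ Φ (sem (if b then t₁ else t₀) y) y
  sem-asked Φ π i t₀ t₁ b eq x rewrite lookup-answer π i x eq with b
  ... | false = refl
  ... | true  = refl

  sem-fresh : ∀ {n} (Φ : ℚᵘ → Vec Bool n → ℚᵘ) (π : Path n) i (t₀ t₁ : RDT n) b →
              answer π i ≡ nothing → ∀ x → let y = override ((i , b) ∷ π) x in
              Φ (sem (decision i t₀ t₁) y) y ≡ Φ (sem (if b then t₁ else t₀) y) y
  sem-fresh Φ π i t₀ t₁ b eq x
    rewrite trans (lookup-fresh π i (x [ i ]≔ b) eq) (lookup∘update i x b) with b
  ... | false = refl
  ... | true  = refl

  𝔼-fresh : ∀ {n} (Φ : ℚᵘ → Vec Bool n → ℚᵘ) (π : Path n) i (t₀ t₁ : RDT n) →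
            answer π i ≡ nothing →
            𝔼[ (λ x → Φ (sem (decision i t₀ t₁) x) x) ∣ π ] ≃
            average 𝔼[ (λ x → Φ (sem t₀ x) x) ∣ (i , false) ∷ π ]
                    𝔼[ (λ x → Φ (sem t₁ x) x) ∣ (i , true) ∷ π ]
  𝔼-fresh Φ π i t₀ t₁ eq =
    ≃-trans (𝔼-split i λ x → Φ (sem (decision i t₀ t₁) (override π x)) (override π x))
            (average-cong (𝔼-cong λ x → ≃-reflexive (sem-fresh Φ π i t₀ t₁ false eq x))
                          (𝔼-cong λ x → ≃-reflexive (sem-fresh Φ π i t₀ t₁ true eq x)))

  𝔼-asked : ∀ {n} (Φ : ℚᵘ → Vec Bool n → ℚᵘ) (π : Path n) i (t₀ t₁ : RDT n) {b} →
            answer π i ≡ just b →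
            𝔼[ (λ x → Φ (sem (decision i t₀ t₁) x) x) ∣ π ] ≃
            𝔼[ (λ x → Φ (sem (if b then t₁ else t₀) x) x) ∣ π ]
  𝔼-asked Φ π i t₀ t₁ {b} eq = 𝔼-cong λ x → ≃-reflexive (sem-asked Φ π i t₀ t₁ b eq x)

  𝔼-affine : ∀ {n} a b (f : Vec Bool n → ℚᵘ) (π : Path n) →
             𝔼[ (λ x → a * f x + b) ∣ π ] ≃ a * 𝔼[ f ∣ π ] + b
  𝔼-affine {n} a b f π =
    ≃-trans (𝔼-+ (λ x → a * f (override π x)) (λ _ → b))
            (+-cong (𝔼-* a λ x → f (override π x)) (𝔼-const {n} b))

  module _ (_∼_ : ℚᵘ → ℚᵘ → Set)
           (∼-resp : ∀ {p q r} → p ≃ q → q ∼ r → p ∼ r)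
           (∼-average : ∀ {p q r s} → p ∼ r → q ∼ s → average p q ∼ average r s)
           {n} (α β : Vec Bool n → ℚᵘ) (g : Label → Path n → Label)
           (at-leaf : ∀ v π → 𝔼[ (λ x → α x * value v + β x) ∣ π ] ∼ value (g v π))
    where

    private
      Φ : ℚᵘ → Vec Bool n → ℚᵘ
      Φ s x = α x * s + β x

    -- An integrand that is affine in the output of the tree is averaged by stochastic
    -- nodes just as by decision nodes, so a comparison at the leaves extends to the
    -- whole tree.  It is used with equality for means and with ≤ for the energy.
    expect-compare : ∀ T π → 𝔼[ (λ x → Φ (sem T x) x) ∣ π ] ∼ value (expect g T π)
    expect-compare (leaf v) π = at-leaf v π
    expect-compare (decision i t₀ t₁) π with answer π i in eq
    ... | nothing    = ∼-resp (𝔼-fresh Φ π i t₀ t₁ eq)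
                              (∼-average (expect-compare t₀ _) (expect-compare t₁ _))
    ... | just false = ∼-resp (𝔼-asked Φ π i t₀ t₁ eq) (expect-compare t₀ π)
    ... | just true  = ∼-resp (𝔼-asked Φ π i t₀ t₁ eq) (expect-compare t₁ π)
    expect-compare (stochastic t₀ t₁) π =
      ∼-resp (≃-trans (𝔼-cong λ x → linear (override π x))
                      (𝔼-average (λ x → Φ (sem t₀ (override π x)) (override π x)) _))
             (∼-average (expect-compare t₀ π) (expect-compare t₁ π))
      where
      linear : ∀ x → Φ (average (sem t₀ x) (sem t₁ x)) x ≃
                     average (Φ (sem t₀ x) x) (Φ (sem t₁ x) x)
      linear x =
        ≃-trans (+-congʳ (α x * average (sem t₀ x) (sem t₁ x)) (≃-sym (average-idem (β x))))
                (solve 5 (λ h a s t b → a :* (h :* (s :+ t)) :+ h :* (b :+ b) :=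
                                        h :* ((a :* s :+ b) :+ (a :* t :+ b))) ≃-refl
                       ½ (α x) (sem t₀ x) (sem t₁ x) (β x))

  mean-correct : ∀ {n} (T : RDT n) π → value (mean T π) ≃ 𝔼[ sem T ∣ π ]
  mean-correct {n} T π =
    ≃-trans (≃-sym (expect-compare _≃_ ≃-trans average-cong (λ _ → 1ℚᵘ) (λ _ → 0ℚᵘ) (λ v _ → v)
                                   (λ v π → ≃-trans (𝔼-cong {n} λ _ → simplify (value v)) (𝔼-const {n} (value v)))
                                   T π))
            (𝔼-cong λ x → simplify (sem T (override π x)))
    where
    simplify : ∀ p → 1ℚᵘ * p + 0ℚᵘ ≃ p
    simplify p = ≃-trans (+-identityʳ (1ℚᵘ * p)) (*-identityˡ p)

  module Progress {n} (R : RDT n) where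

    secondMoment : Path n → ℚᵘ
    secondMoment π = 𝔼[ (λ x → sq (sem R x)) ∣ π ]

    μ : Path n → ℚᵘ
    μ π = value (mean R π)

    variance : Path n → ℚᵘ
    variance π = secondMoment π - sq (μ π)

    deviation : ∀ c π → 𝔼[ (λ x → sq (c - sem R x)) ∣ π ] ≃ sq c + (- (c + c) * μ π + secondMoment π)
    deviation c π =
      ≃-trans (𝔼-cong λ x → expand (sem R (override π x)))
     (≃-trans (𝔼-+ (λ _ → sq c) (λ x → - (c + c) * f x + sq (f x)))
              (+-cong (𝔼-const {n} (sq c))
                (≃-trans (𝔼-+ (λ x → - (c + c) * f x) (λ x → sq (f x)))
                         (+-congˡ (secondMoment π) (≃-trans (𝔼-* (- (c + c)) f)
                                                      (*-congˡ { - (c + c)} (≃-sym (mean-correct R π))))))))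
      where
      f : Vec Bool n → ℚᵘ
      f x = sem R (override π x)
      expand : ∀ y → sq (c - y) ≃ sq c + (- (c + c) * y + sq y)
      expand y = solve 2 (λ c y → (c :- y) :* (c :- y) := c :* c :+ (:- (c :+ c) :* y :+ y :* y)) ≃-refl c y

    -- The mean is the best constant prediction, with the variance as its error.
    error-at-leaf : ∀ π → 𝔼[ (λ x → sq (μ π - sem R x)) ∣ π ] ≃ variance π
    error-at-leaf π = ≃-trans (deviation (μ π) π)
      (solve 2 (λ m s → m :* m :+ (:- (m :+ m) :* m :+ s) := s :- m :* m) ≃-refl (μ π) (secondMoment π))

    variance-nonNeg : ∀ π → 0ℚᵘ ≤ variance π
    variance-nonNeg π = ≤-respʳ-≃ (error-at-leaf π)
      (≤-respˡ-≃ (𝔼-const {n} 0ℚᵘ) (𝔼-mono λ x → sq-nonNeg (μ π - sem R (override π x))))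

    -- One random run of R gains at least V² in expectation.  The integrand α·h + β below is
    -- 2V(f − μ)(h − μ) + 2μf − μ² − V², for the output h of the tree.  At a leaf with
    -- constant h its average is at most μ(π′)², because (μ(π′) − μ − V(h − μ))² ≥ 0 and
    -- (h − μ)² ≤ 1.  At the root h averages to f, and the average is μ² + V².
    progress : ∀ π → sq (μ π) + sq (variance π) ≤ value (energy R R π)
    progress π = ≤-respˡ-≃ at-root
      (expect-compare _≤_ ≤-respˡ-≃′ average-mono α β (squaredMean R) at-leaf R π)
      where
      m V : ℚᵘ
      m = μ π
      V = variance π
      f α β : Vec Bool n → ℚᵘ
      f = sem R
      α x = (V + V) * (f x - m)
      β x = (m + m) * f x - (V + V) * m * (f x - m) - (sq V + sq m)

      ≤-respˡ-≃′ : ∀ {p q r} → p ≃ q → q ≤ r → p ≤ r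
      ≤-respˡ-≃′ eq = ≤-respˡ-≃ (≃-sym eq)

      at-leaf : ∀ v π′ → 𝔼[ (λ x → α x * value v + β x) ∣ π′ ] ≤ value (squaredMean R v π′)
      at-leaf v π′ = ≤-respˡ-≃ (≃-sym affine) (≤-by-difference 0≤squares complete)
        where
        u a b : ℚᵘ
        u = value v
        a = (V + V) * (u - m) + (m + m)
        b = - ((V + V) * (u - m) * m) - (sq V + sq m)
        affine : 𝔼[ (λ x → α x * u + β x) ∣ π′ ] ≃ a * μ π′ + b
        affine = ≃-trans
          (𝔼-cong λ x → solve 4 (λ V m u y →
               (V :+ V) :* (y :- m) :* u :+
                 ((m :+ m) :* y :- (V :+ V) :* m :* (y :- m) :- (V :* V :+ m :* m))
            := ((V :+ V) :* (u :- m) :+ (m :+ m)) :* y :+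
                 (:- ((V :+ V) :* (u :- m) :* m) :- (V :* V :+ m :* m)))
            ≃-refl V m u (f (override π′ x)))
          (≃-trans (𝔼-affine a b f π′) (+-congˡ b (*-congˡ {a} (≃-sym (mean-correct R π′)))))
        0≤squares : 0ℚᵘ ≤ sq ((μ π′ - m) - V * (u - m)) + sq V * (1ℚᵘ - sq (u - m))
        0≤squares = +-nonNeg (sq-nonNeg ((μ π′ - m) - V * (u - m)))
                          (*-nonNeg (sq-nonNeg V) (unit-gap v (mean R π)))
        complete : sq (μ π′) - (a * μ π′ + b) ≃
                   sq ((μ π′ - m) - V * (u - m)) + sq V * (1ℚᵘ - sq (u - m))
        complete = solve 4 (λ V m u p →
             p :* p :- (((V :+ V) :* (u :- m) :+ (m :+ m)) :* p :+
                        (:- ((V :+ V) :* (u :- m) :* m) :- (V :* V :+ m :* m)))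
          := ((p :- m) :- V :* (u :- m)) :* ((p :- m) :- V :* (u :- m)) :+
             V :* V :* (con 1ℚᵘ :- (u :- m) :* (u :- m)))
          ≃-refl V m u (μ π′)

      at-root : 𝔼[ (λ x → α x * f x + β x) ∣ π ] ≃ sq m + sq V
      at-root =
        ≃-trans (𝔼-cong λ x → solve 3 (λ V m y →
             (V :+ V) :* (y :- m) :* y :+
               ((m :+ m) :* y :- (V :+ V) :* m :* (y :- m) :- (V :* V :+ m :* m))
          := (V :+ V) :* ((m :- y) :* (m :- y)) :+ ((m :+ m) :* y :+ (:- (V :* V :+ m :* m))))
          ≃-refl V m (f (override π x)))
        (≃-trans (𝔼-+ (λ x → (V + V) * sq (m - f (override π x))) (λ x → (m + m) * f (override π x) + c))
        (≃-trans (+-cong (≃-trans (𝔼-* (V + V) λ x → sq (m - f (override π x)))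
                                  (*-congˡ {V + V} (error-at-leaf π)))
                         (≃-trans (𝔼-affine (m + m) c f π)
                                  (+-congˡ c (*-congˡ {m + m} (≃-sym (mean-correct R π))))))
          (solve 2 (λ V m → (V :+ V) :* V :+ ((m :+ m) :* m :+ (:- (V :* V :+ m :* m)))
                         := m :* m :+ V :* V) ≃-refl V m)))
        where
        c : ℚᵘ
        c = - (sq V + sq m)

  decisionFree-constant : ∀ {n} (T : RDT n) → decisionsSeen T ≡ 0 →
                          ∀ π x → sem T x ≃ value (mean T π)
  decisionFree-constant (leaf v)           eq π x = ≃-refl
  decisionFree-constant (stochastic t₀ t₁) eq π x = average-cong
    (decisionFree-constant t₀ (ℕ.m+n≡0⇒m≡0 (decisionsSeen t₀) eq) π x)
    (decisionFree-constant t₁ (ℕ.m+n≡0⇒n≡0 (decisionsSeen t₀) eq) π x)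

  ι : ℕ → ℚᵘ
  ι k = + k / 1

  ι-suc : ∀ k → ι (suc k) ≃ ι k + 1ℚᵘ
  ι-suc k = *≡* (cong (ℤ._* + 1) (trans (ℤ.+-comm (+ 1) (+ k))
                                        (cong (ℤ._+ + 1) (sym (ℤ.*-identityʳ (+ k))))))

  cross-≤ : ∀ (p q : Label) → ∣ ↥ value p ∣ ℕ.* ↧ₙ (value q) ℕ.≤ ∣ ↥ value q ∣ ℕ.* ↧ₙ (value p) →
            value p ≤ value q
  cross-≤ (label p@record{} 0≤p _) (label q@record{} 0≤q _) le = *≤* (subst₂ ℤ._≤_
      (trans (ℤ.pos-* ∣ ↥ p ∣ (↧ₙ q)) (cong (ℤ._* ↧ q) (numerator p 0≤p)))
      (trans (ℤ.pos-* ∣ ↥ q ∣ (↧ₙ p)) (cong (ℤ._* ↧ p) (numerator q 0≤q)))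
      (+≤+ le))
    where
    numerator : ∀ r → 0ℚᵘ ≤ r → + ∣ ↥ r ∣ ≡ ↥ r
    numerator (mkℚᵘ (+ _) _) _ = refl
    numerator (mkℚᵘ ℤ.-[1+ _ ] _) (*≤* ())

  excess-zero : ∀ p q → excess p q ≡ 0 → value q ≤ value p
  excess-zero p q eq = cross-≤ q p (ℕ.m∸n≡0⇒m≤n eq)

  excess-suc : ∀ p q {e} → excess p q ≡ suc e → value p ≤ value q
  excess-suc p q eq = cross-≤ p q
    (ℕ.<⇒≤ (ℕ.m∸n≢0⇒n<m λ eq′ → ℕ.0≢1+n (trans (sym eq′) eq)))

  average-≤ˡ : ∀ {p q} → q ≤ p → average p q ≤ p
  average-≤ˡ {p} q≤p = ≤-respʳ-≃ (average-idem p) (average-mono (≤-refl {p}) q≤p)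

  average-≤ʳ : ∀ {p q} → p ≤ q → average p q ≤ q
  average-≤ʳ {p} {q} p≤q = ≤-respʳ-≃ (average-idem q) (average-mono p≤q (≤-refl {q}))

  -- The difference of the two sides is ((m + 1)v − 1)² + v.
  decay : ∀ {m v} → 0ℚᵘ ≤ v → sq (m + 1ℚᵘ) * (v - sq v) ≤ sq m * v + 1ℚᵘ
  decay {m} {v} 0≤v = ≤-by-difference (+-nonNeg (sq-nonNeg ((m + 1ℚᵘ) * v - 1ℚᵘ)) 0≤v)
    (solve 2 (λ m v →
        (m :* m :* v :+ con 1ℚᵘ) :- ((m :+ con 1ℚᵘ) :* (m :+ con 1ℚᵘ)) :* (v :- v :* v)
     := ((m :+ con 1ℚᵘ) :* v :- con 1ℚᵘ) :* ((m :+ con 1ℚᵘ) :* v :- con 1ℚᵘ) :+ v)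
     ≃-refl m v)

  module _ {n} (R : RDT n) where
    open Progress R

    error : RDT n → Path n → ℚᵘ
    error D π = 𝔼[ (λ x → sq (sem D x - sem R x)) ∣ π ]

    -- Bounds (m + k)² times the final error, where m counts the rounds up to the current
    -- one and k those still to come: the variance expected after the current round has
    -- weight m², and every further round adds at most 1 by `decay`.
    budget : ℕ → ℕ → Path n → ℚᵘ → ℚᵘ
    budget m k π e = sq (ι m) * (secondMoment π - e) + ι k

    -- Choosing the subtree of larger energy only lowers the budget.
    budget-antimono : ∀ m k π {e e′} → e ≤ e′ → budget m k π e′ ≤ budget m k π e
    budget-antimono m k π e≤e′ =
      +-monoˡ-≤ (ι k) (*-monoʳ-≤-nonNeg (sq (ι m)) ⦃ nonNegative (sq-nonNeg (ι m)) ⦄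
                        (+-monoʳ-≤ (secondMoment π) (neg-mono-≤ e≤e′)))

    budget-average : ∀ m k π i e₀ e₁ →
      average (budget m k ((i , false) ∷ π) e₀) (budget m k ((i , true) ∷ π) e₁) ≃
      budget m k π (average e₀ e₁)
    budget-average m k π i e₀ e₁ =
      ≃-trans (solve 7 (λ h s F₀ F₁ e₀ e₁ k →
           h :* ((s :* (F₀ :- e₀) :+ k) :+ (s :* (F₁ :- e₁) :+ k))
        := s :* (h :* (F₀ :+ F₁) :- h :* (e₀ :+ e₁)) :+ h :* (k :+ k))
        ≃-refl ½ (sq (ι m)) (secondMoment ((i , false) ∷ π)) (secondMoment ((i , true) ∷ π)) e₀ e₁ (ι k))
      (+-cong (*-congˡ {sq (ι m)} (+-congˡ (- average e₀ e₁)
                (≃-sym (𝔼-split i λ x → sq (sem R (override π x))))))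
              (average-idem (ι k)))

    -- At a leaf, the energy is the current μ², and restarting R replaces it by the
    -- energy of R.
    next-round : ∀ m k π → budget (suc m) k π (value (energy R R π)) ≤
                           budget m (suc k) π (sq (μ π))
    next-round m k π =
      ≤-trans (budget-antimono (suc m) k π (progress π))
     (≤-respˡ-≃ (≃-sym left) (≤-respʳ-≃ (≃-sym right)
       (+-monoˡ-≤ (ι k) (decay {ι m} (variance-nonNeg π)))))
      where
      M F : ℚᵘ
      M = ι m
      F = secondMoment π
      left : budget (suc m) k π (sq (μ π) + sq (variance π)) ≃
             sq (M + 1ℚᵘ) * (variance π - sq (variance π)) + ι k
      left = +-congˡ (ι k) (*-cong (*-cong (ι-suc m) (ι-suc m))
        (solve 3 (λ F a b → F :- (a :+ b) := (F :- a) :- b) ≃-refl F (sq (μ π)) (sq (variance π))))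
      right : budget m (suc k) π (sq (μ π)) ≃ sq M * variance π + 1ℚᵘ + ι k
      right = ≃-trans (+-congʳ (sq M * variance π) (ι-suc k))
        (solve 2 (λ a k → a :+ (k :+ con 1ℚᵘ) := a :+ con 1ℚᵘ :+ k) ≃-refl (sq M * variance π) (ι k))

    scaled : ℕ → RDT n → Path n → ℚᵘ
    scaled K D π = sq (ι K) * error D π

    scaled-fresh : ∀ K π i (D₀ D₁ : RDT n) → answer π i ≡ nothing →
      scaled K (decision i D₀ D₁) π ≃
      average (scaled K D₀ ((i , false) ∷ π)) (scaled K D₁ ((i , true) ∷ π))
    scaled-fresh K π i D₀ D₁ eq = ≃-trans
      (*-congˡ {sq (ι K)} (𝔼-fresh (λ s x → sq (s - sem R x)) π i D₀ D₁ eq))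
      (solve 4 (λ s h a b → s :* (h :* (a :+ b)) := h :* (s :* a :+ s :* b)) ≃-refl
        (sq (ι K)) ½ (error D₀ ((i , false) ∷ π)) (error D₁ ((i , true) ∷ π)))

    -- At a decision node both sides average over the two answers; at a stochastic node
    -- the chosen energy is at least the average one; at a leaf the next round starts,
    -- or the variance is the error.
    build-error : ∀ T k m π → scaled (m ℕ.+ k) (build R T k π) π ≤ budget m k π (value (energy R T π))
    build-error (leaf v) zero m π = ≤-reflexive (≃-trans
      (*-cong (≃-reflexive (cong (λ j → sq (ι j)) (ℕ.+-identityʳ m))) (error-at-leaf π))
      (≃-sym (+-identityʳ (sq (ι m) * variance π))))
    build-error (leaf v) (suc k) m π =
      ≤-trans (subst (λ K → scaled K (build R R k π) π ≤ budget (suc m) k π (value (energy R R π)))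
                     (sym (ℕ.+-suc m k)) (build-error R k (suc m) π))
              (next-round m k π)
    build-error (decision i t₀ t₁) k m π with answer π i in eq
    ... | nothing = ≤-respˡ-≃ (≃-sym (scaled-fresh (m ℕ.+ k) π i (build R t₀ k π₀) (build R t₁ k π₁) eq))
                      (≤-respʳ-≃ (budget-average m k π i (value (energy R t₀ π₀)) (value (energy R t₁ π₁)))
                        (average-mono (build-error t₀ k m π₀) (build-error t₁ k m π₁)))
      where π₀ π₁ : Path n
            π₀ = (i , false) ∷ π
            π₁ = (i , true) ∷ π
    ... | just false = build-error t₀ k m π
    ... | just true  = build-error t₁ k m π
    build-error (stochastic t₀ t₁) k m π
      with excess (energy R t₀ π) (energy R t₁ π) in eq
    ... | zero  = ≤-trans (build-error t₀ k m π) (budget-antimono m k π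
                    (average-≤ˡ (excess-zero (energy R t₀ π) (energy R t₁ π) eq)))
    ... | suc _ = ≤-trans (build-error t₁ k m π) (budget-antimono m k π
                    (average-≤ʳ (excess-suc (energy R t₀ π) (energy R t₁ π) eq)))

    -- The walk starts as if a round of weight m = 0 had just ended, so the initial
    -- variance is multiplied by 0.
    rounds-error : ∀ v k → scaled k (build R (leaf v) k []) [] ≤ ι k
    rounds-error v k = ≤-trans (build-error (leaf v) k 0 []) (≤-reflexive
      (≃-trans (+-congˡ (ι k) (*-zeroˡ (secondMoment [] - sq (μ [])))) (+-identityˡ (ι k))))

    error-≤ : ∀ v k {ε} → 1ℚᵘ ≤ ι k * ε → error (build R (leaf v) k []) [] ≤ ε
    error-≤ v zero {ε} 1≤0 with ≤-respʳ-≃ (*-zeroˡ ε) 1≤0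
    ... | *≤* (+≤+ ())
    error-≤ v k@(suc _) {ε} 1≤kε =
      *-cancelˡ-≤-pos (ι k) (*-cancelˡ-≤-pos (ι k)
        (≤-respˡ-≃ (*-assoc (ι k) (ι k) (error (build R (leaf v) k []) []))
          (≤-trans (rounds-error v k)
            (≤-respˡ-≃ (*-identityʳ (ι k)) (*-monoʳ-≤-nonNeg (ι k) 1≤kε)))))

-- The program and its running time

module Complexity where

  open import Data.Bool using (Bool; true; false; T)
  open import Data.Fin using (Fin; zero; suc; #_; toℕ)
  open import Data.Fin.Properties using (_≟_; toℕ-injective)
  open import Data.Integer as ℤ using (∣_∣; +≤+)
  import Data.Integer.Properties as ℤ
  open import Data.List using (List; []; _∷_; _++_; length)
  open import Data.Maybe using (Maybe; just; nothing)
  open import Data.Nat using (ℕ; zero; suc; _+_; _*_; _∸_; _^_; _⊔_; _≤_; _<_; _≤ᵇ_; ⌈_/2⌉; ⌊_/2⌋; s≤s; z≤n; >-nonZero)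
  open import Data.Nat.Induction using (<-rec)
  open import Data.Nat.ListAction using (sum)
  open import Data.Nat.ListAction.Properties using (sum-++)
  open import Data.Nat.Logarithm
  open import Data.Nat.Properties hiding (_≟_)
  open import Data.Nat.Solver
  open +-*-Solver using (solve; _:+_; _:*_; _:=_; con; Polynomial)
  open import Data.Product using (∃-syntax; _×_; _,_; proj₁; proj₂)
  open import Data.Rational.Unnormalised using (mkℚᵘ; ↥_; ↧ₙ_; 0ℚᵘ; *≤*)
  import Data.Rational.Unnormalised.Properties as ℚ
  open import Data.Sum using (_⊎_; inj₁; inj₂)
  open import Data.Vec using (Vec; []; _∷_; lookup)
  open import Relation.Binary.PropositionalEquality using (_≡_; _≢_; refl; sym; trans; cong; cong₂; subst; subst₂)
  open import Relation.Nullary using (yes; no)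
  open Derandomization

  build-queries : ∀ {n} (R T : RDT n) k π →
                  queryComplexity (build R T k π) ≤ queryComplexity T + k * queryComplexity R
  build-queries R (leaf v)           zero    π = z≤n
  build-queries R (leaf v)           (suc k) π = build-queries R R k π
  build-queries R (decision i t₀ t₁) k       π with answer π i
  ... | nothing = s≤s (⊔-lub
    (≤-trans (build-queries R t₀ k _) (+-monoˡ-≤ _ (m≤m⊔n (queryComplexity t₀) (queryComplexity t₁))))
    (≤-trans (build-queries R t₁ k _) (+-monoˡ-≤ _ (m≤n⊔m (queryComplexity t₀) (queryComplexity t₁)))))
  ... | just false = ≤-trans (build-queries R t₀ k π)
    (+-monoˡ-≤ _ (m≤n⇒m≤1+n (m≤m⊔n (queryComplexity t₀) (queryComplexity t₁))))
  ... | just true = ≤-trans (build-queries R t₁ k π)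
    (+-monoˡ-≤ _ (m≤n⇒m≤1+n (m≤n⊔m (queryComplexity t₀) (queryComplexity t₁))))
  build-queries R (stochastic t₀ t₁) k π =
    choose-preserves (λ D → queryComplexity D ≤ queryComplexity t₀ ⊔ queryComplexity t₁ + k * queryComplexity R)
      (excess (energy R t₀ π) (energy R t₁ π))
      (≤-trans (build-queries R t₀ k π) (+-monoˡ-≤ _ (m≤m⊔n (queryComplexity t₀) (queryComplexity t₁))))
      (≤-trans (build-queries R t₁ k π) (+-monoˡ-≤ _ (m≤n⊔m (queryComplexity t₀) (queryComplexity t₁))))

  decisionsSeen-suc : ∀ {n} (T : RDT n) {j} → decisionsSeen T ≡ suc j → 1 ≤ queryComplexity T
  decisionsSeen-suc (decision _ _ _)   eq = s≤s z≤n
  decisionsSeen-suc (stochastic t₀ t₁) eq with decisionsSeen t₀ in eq₀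
  ... | zero  = ≤-trans (decisionsSeen-suc t₁ eq) (m≤n⊔m (queryComplexity t₀) _)
  ... | suc _ = ≤-trans (decisionsSeen-suc t₀ eq₀) (m≤m⊔n _ (queryComplexity t₁))

  -- The program has one global function for each step of the algorithm.  A line inside
  -- an expression lists the latest variables of the environment at that place,
  -- variable 0 first.
  private
    E : ℕ → Set
    E = Exp 9

  pattern mainᶠ    = zero
  pattern answerᶠ  = suc zero
  pattern averageᶠ = suc (suc zero)
  pattern squareᶠ  = suc (suc (suc zero))
  pattern expectᶠ  = suc (suc (suc (suc zero)))
  pattern excessᶠ  = suc (suc (suc (suc (suc zero))))
  pattern buildᶠ   = suc (suc (suc (suc (suc (suc zero)))))
  pattern roundsᶠ  = suc (suc (suc (suc (suc (suc (suc zero))))))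
  pattern decisionsᶠ = suc (suc (suc (suc (suc (suc (suc (suc zero)))))))

  -- The branch for ill-formed data, which never occurs.
  stuck : ∀ {n} → E n
  stuck = nat 0

  v0 : ∀ {n} → E (1 + n)
  v0 = var (# 0)
  v1 : ∀ {n} → E (2 + n)
  v1 = var (# 1)
  v2 : ∀ {n} → E (3 + n)
  v2 = var (# 2)
  v3 : ∀ {n} → E (4 + n)
  v3 = var (# 3)
  v4 : ∀ {n} → E (5 + n)
  v4 = var (# 4)
  v5 : ∀ {n} → E (6 + n)
  v5 = var (# 5)
  v6 : ∀ {n} → E (7 + n)
  v6 = var (# 6)
  v7 : ∀ {n} → E (8 + n)
  v7 = var (# 7)
  v8 : ∀ {n} → E (9 + n)
  v8 = var (# 8)

  triple : ∀ {n} → E n → E n → E n → E n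
  triple a b c = pair a (pair b c)

  -- On ⟪ i , π ⟫: 0 if i is fresh, and otherwise 1 or 2 for the answers 0 and 1.
  answerᵉ : E 1
  answerᵉ = case v0 stuck (case v1 (nat 0)
    -- head tail i π
    (let′ (call answerᶠ (pair v2 v1))
      -- r head tail i π
      (if0 v0
        (case v1 stuck
          -- j b r head tail i π
          (if0 (op add (op monus v5 v0) (op monus v0 v5)) v1 (nat 0)))
        v0)))

  -- The fraction is not reduced, in agreement with addition and multiplication of
  -- unnormalised rationals.
  averageᵉ : E 1
  averageᵉ = case v0 stuck (case v0 stuck (case v3 stuck
    -- c d a b p q
    (pair (op add (op mul v2 v1) (op mul v0 v3))
          (op mul (nat 2) (op mul v3 v1)))))

  squareᵉ : E 1
  squareᵉ = case v0 stuck (pair (op mul v0 v0) (op mul v1 v1))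

  excessᵉ : E 1
  excessᵉ = case v0 stuck (case v0 stuck (case v3 stuck
    -- c d a b p q
    (op monus (op mul v0 v3) (op mul v2 v1))))

  -- The case distinction shared by `expectᵉ` and `buildᵉ`, on ⟪ T , ⟪ M , π ⟫ ⟫, where
  -- M is passed on unchanged.
  traverse : Fin 9 → E 7 → (E 12 → E 12 → E 12) → E 9 → E 1
  traverse self atLeaf join atStochastic =
    case v0 stuck (case v1 stuck (case v2 stuck
      -- tag body M π T
      (if0 v0 atLeaf
      (if0 (op monus v0 (nat 1))
        (case v1 stuck (case v1 stuck
          -- t₀ t₁ i ts tag body M π
          (let′ (call answerᶠ (pair v2 v7))
            -- r t₀ t₁ i ts tag body M π
            (if0 v0
              (join (call self (triple v1 v7 (pair (pair v3 (nat 1)) v8)))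
                    (call self (triple v2 v7 (pair (pair v3 (nat 2)) v8))))
              (if0 (op monus v0 (nat 1))
                (call self (triple v1 v7 v8))
                (call self (triple v2 v7 v8)))))))
        (case v1 stuck
          -- t₀ t₁ tag body M π
          atStochastic)))))

  -- M selects the function averaged: a number for the label itself, the code of a tree
  -- R for the squared mean of R at the leaf.
  expectᵉ : E 1
  expectᵉ = traverse expectᶠ
    (case v2 v1 (call squareᶠ (call expectᶠ (triple v4 (nat 0) v5))))
    (λ a b → call averageᶠ (pair a b))
    (call averageᶠ (pair (call expectᶠ (triple v0 v4 v5)) (call expectᶠ (triple v1 v4 v5))))

  -- Here M is ⟪ R , k ⟫.
  buildᵉ : E 1
  buildᵉ = traverse buildᶠ
    (case v2 stuck
      -- R k tag body M π
      (if0 v1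
        (pair (nat 0) (call expectᶠ (triple v0 (nat 0) v5)))
        (call buildᶠ (triple v0 (pair v0 (op monus v1 (nat 1))) v5))))
    (λ a b → pair (nat 1) (triple v3 a b))
    (case v4 stuck
      -- R k t₀ t₁ tag body M π
      (if0 (call excessᶠ (pair (call expectᶠ (triple v2 v0 v7)) (call expectᶠ (triple v3 v0 v7))))
        (call buildᶠ (triple v2 v6 v7))
        (call buildᶠ (triple v3 v6 v7))))

  -- On ⟪ a , b ⟫ this counts how often a can be subtracted from b, that is ⌈b / a⌉.
  roundsᵉ : E 1
  roundsᵉ = case v0 stuck (if0 v1 (nat 0)
    (op add (nat 1) (call roundsᶠ (pair v0 (op monus v1 v0)))))

  decisionsᵉ : E 1
  decisionsᵉ = case v0 stuck (if0 v0 (nat 0)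
    -- tag body
    (if0 (op monus v0 (nat 1)) (nat 1)
      (case v1 stuck (op add (call decisionsᶠ v0) (call decisionsᶠ v1)))))

  -- Environment: the numerator and the denominator of ε, then R.
  roundsExp : Exp 9 5
  roundsExp = if0 (call decisionsᶠ v2) (nat 0) (call roundsᶠ (pair v0 v1))

  -- The build starts at a dummy leaf with label 0 / 1, whose end of round starts the
  -- first of the rounds.
  mainᵉ : E 1
  mainᵉ = case v0 stuck (case v1 stuck
    -- a b R ε
    (call buildᶠ (triple (triple (nat 0) (nat 0) (nat 1))
      (pair v2 roundsExp) (nat 0))))

  program : Functions 9
  program mainᶠ      = mainᵉ
  program answerᶠ    = answerᵉ
  program averageᶠ   = averageᵉ
  program squareᶠ    = squareᵉ
  program expectᶠ    = expectᵉ
  program excessᶠ    = excessᵉ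
  program buildᶠ     = buildᵉ
  program roundsᶠ    = roundsᵉ
  program decisionsᶠ = decisionsᵉ

  -- The time of e is at most c plus the sum of xs.  Keeping the numeral c apart from the
  -- symbolic costs xs lets both be computed from the derivation alone.
  record Runs {n} (ρ : Vec Val n) (e : Exp 9 n) (v : Val) (c : ℕ) (xs : List ℕ) : Set where
    constructor _▹_
    field
      {time}     : ℕ
      evaluation : program , ρ ⊢ e ⇓ v ∶ time
      time-≤     : time ≤ c + sum xs

  record Computes (f : Fin 9) (u v : Val) (b : ℕ) : Set where
    constructor _▹_
    field
      {time}     : ℕ
      evaluation : program , u ∷ [] ⊢ program f ⇓ v ∶ time
      time-≤     : time ≤ b

  together : ∀ {s t} c d xs ys → s ≤ c + sum xs → t ≤ d + sum ys → s + t ≤ (c + d) + sum (xs ++ ys)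
  together {s} {t} c d xs ys p q = begin
    s + t                          ≤⟨ +-mono-≤ p q ⟩
    (c + sum xs) + (d + sum ys)    ≡⟨ solve 4 (λ c x d y → (c :+ x) :+ (d :+ y) := (c :+ d) :+ (x :+ y))
                                            refl c (sum xs) d (sum ys) ⟩
    (c + d) + (sum xs + sum ys)    ≡⟨ cong (c + d +_) (sym (sum-++ xs ys)) ⟩
    (c + d) + sum (xs ++ ys)       ∎
    where open ≤-Reasoning
          open +-*-Solver

  module _ {n} {ρ : Vec Val n} where

    castʳ : ∀ {e u v c xs} → u ≡ v → Runs ρ e u c xs → Runs ρ e v c xs
    castʳ refl r = r

    varʳ : ∀ {i} → Runs ρ (var i) (lookup ρ i) 1 []
    varʳ = var ▹ ≤-refl

    natʳ : ∀ {a} → Runs ρ (nat a) (nat a) 1 []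
    natʳ = nat ▹ ≤-refl

    mulʳ : ∀ {e₁ e₂ a b c d xs ys} w → opCost mul a b ≤ w → Runs ρ e₁ (nat a) c xs → Runs ρ e₂ (nat b) d ys →
           Runs ρ (op mul e₁ e₂) (nat (a * b)) (c + d) (xs ++ ys ++ w ∷ [])
    mulʳ {a = a} {b} {c} {d} {xs} {ys} w o≤w (_▹_ {s} p s≤) (_▹_ {t} q t≤) = op p q ▹
      ≤-trans (≤-reflexive (+-assoc s t (opCost mul a b))) (together c d xs (ys ++ w ∷ []) s≤
        (≤-trans (+-mono-≤ t≤ o≤w) (≤-reflexive
          (trans (+-assoc d (sum ys) w) (cong (d +_)
            (trans (cong (sum ys +_) (sym (+-identityʳ w))) (sym (sum-++ ys (w ∷ [])))))))))

    addʳ : ∀ {e₁ e₂ a b c d xs ys} → Runs ρ e₁ (nat a) c xs → Runs ρ e₂ (nat b) d ys →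
           Runs ρ (op add e₁ e₂) (nat (a + b)) (suc (c + d)) (xs ++ ys)
    addʳ {c = c} {d} {xs} {ys} (p ▹ s≤) (q ▹ t≤) = op p q ▹
      ≤-trans (≤-reflexive (+-comm _ 1)) (s≤s (together c d xs ys s≤ t≤))

    monusʳ : ∀ {e₁ e₂ a b c d xs ys} → Runs ρ e₁ (nat a) c xs → Runs ρ e₂ (nat b) d ys →
             Runs ρ (op monus e₁ e₂) (nat (a ∸ b)) (suc (c + d)) (xs ++ ys)
    monusʳ {c = c} {d} {xs} {ys} (p ▹ s≤) (q ▹ t≤) = op p q ▹
      ≤-trans (≤-reflexive (+-comm _ 1)) (s≤s (together c d xs ys s≤ t≤))

    pairʳ : ∀ {e₁ e₂ u v c d xs ys} → Runs ρ e₁ u c xs → Runs ρ e₂ v d ys →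
            Runs ρ (pair e₁ e₂) ⟪ u , v ⟫ (suc (c + d)) (xs ++ ys)
    pairʳ {c = c} {d} {xs} {ys} (p ▹ s≤) (q ▹ t≤) =
      pair p q ▹ s≤s (together c d xs ys s≤ t≤)

    tripleʳ : ∀ {e₁ e₂ e₃ u v w b c d xs ys zs} → Runs ρ e₁ u b xs → Runs ρ e₂ v c ys → Runs ρ e₃ w d zs →
              Runs ρ (triple e₁ e₂ e₃) ⟪ u , ⟪ v , w ⟫ ⟫ (suc (b + suc (c + d))) (xs ++ ys ++ zs)
    tripleʳ {b = b} {c} {d} {xs} {ys} {zs} (p ▹ r≤) (q ▹ s≤) (r ▹ t≤) =
      pair p (pair q r) ▹ s≤s (together b (suc (c + d)) xs (ys ++ zs) r≤ (s≤s (together c d ys zs s≤ t≤)))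

    letʳ : ∀ {e₁ e₂ u v c d xs ys} → Runs ρ e₁ u c xs → Runs (u ∷ ρ) e₂ v d ys →
           Runs ρ (let′ e₁ e₂) v (suc (c + d)) (xs ++ ys)
    letʳ {c = c} {d} {xs} {ys} (p ▹ s≤) (q ▹ t≤) =
      let′ p q ▹ s≤s (together c d xs ys s≤ t≤)

    if0ᶻ : ∀ {e e₀ e₁ v c d xs ys} → Runs ρ e (nat 0) c xs → Runs ρ e₀ v d ys →
           Runs ρ (if0 e e₀ e₁) v (suc (c + d)) (xs ++ ys)
    if0ᶻ {c = c} {d} {xs} {ys} (p ▹ s≤) (q ▹ t≤) =
      if0-zero p q ▹ s≤s (together c d xs ys s≤ t≤)

    if0ˢ : ∀ {e e₀ e₁ a v c d xs ys} → Runs ρ e (nat (suc a)) c xs → Runs ρ e₁ v d ys →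
           Runs ρ (if0 e e₀ e₁) v (suc (c + d)) (xs ++ ys)
    if0ˢ {c = c} {d} {xs} {ys} (p ▹ s≤) (q ▹ t≤) =
      if0-suc p q ▹ s≤s (together c d xs ys s≤ t≤)

    caseⁿ : ∀ {e e₁ e₂ a v c d xs ys} → Runs ρ e (nat a) c xs → Runs ρ e₁ v d ys →
            Runs ρ (case e e₁ e₂) v (suc (c + d)) (xs ++ ys)
    caseⁿ {c = c} {d} {xs} {ys} (p ▹ s≤) (q ▹ t≤) =
      case-nat p q ▹ s≤s (together c d xs ys s≤ t≤)

    caseᵖ : ∀ {e e₁ e₂ a b v c d xs ys} → Runs ρ e ⟪ a , b ⟫ c xs → Runs (a ∷ b ∷ ρ) e₂ v d ys →
            Runs ρ (case e e₁ e₂) v (suc (c + d)) (xs ++ ys)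
    caseᵖ {c = c} {d} {xs} {ys} (p ▹ s≤) (q ▹ t≤) =
      case-pair p q ▹ s≤s (together c d xs ys s≤ t≤)

    callʳ : ∀ {f e u v c b xs} → Runs ρ e u c xs → Computes f u v b →
            Runs ρ (call f e) v (suc c) (xs ++ b ∷ [])
    callʳ {c = c} {b} {xs} (p ▹ s≤) (q ▹ t≤) = call p q ▹
      s≤s (≤-trans (together c 0 xs (b ∷ []) s≤ (≤-trans t≤ (≤-reflexive (sym (+-identityʳ b)))))
                   (≤-reflexive (cong (_+ _) (+-identityʳ c))))

  computes : ∀ {f u v v′ c xs b} → Runs (u ∷ []) (program f) v c xs → v ≡ v′ → c + sum xs ≤ b →
             Computes f u v′ b
  computes (p ▹ t≤) refl le = p ▹ ≤-trans t≤ le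

  -- Halving n upwards lowers its logarithm by one, and n is at most twice its half.
  n≤2^⌈log₂n⌉ : ∀ n → n ≤ 2 ^ ⌈log₂ n ⌉
  n≤2^⌈log₂n⌉ = <-rec _ step
    where
    step : ∀ n → (∀ {m} → m < n → m ≤ 2 ^ ⌈log₂ m ⌉) → n ≤ 2 ^ ⌈log₂ n ⌉
    step zero            rec = z≤n
    step (suc zero)      rec = m^n>0 2 ⌈log₂ 1 ⌉
    step n@(suc (suc m)) rec = begin
      n                                ≡⟨ sym (⌊n/2⌋+⌈n/2⌉≡n n) ⟩
      ⌊ n /2⌋ + ⌈ n /2⌉                ≤⟨ +-monoˡ-≤ ⌈ n /2⌉ (⌊n/2⌋≤⌈n/2⌉ n) ⟩
      ⌈ n /2⌉ + ⌈ n /2⌉                ≤⟨ +-mono-≤ half half ⟩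
      2 ^ (⌈log₂ n ⌉ ∸ 1) + 2 ^ (⌈log₂ n ⌉ ∸ 1)  ≡⟨ cong (λ k → 2 ^ (⌈log₂ n ⌉ ∸ 1) + k) (sym (+-identityʳ _)) ⟩
      2 ^ suc (⌈log₂ n ⌉ ∸ 1)          ≡⟨ cong (2 ^_) (m+[n∸m]≡n (⌈log₂⌉-mono-≤ {2} {n} (s≤s (s≤s z≤n)))) ⟩
      2 ^ ⌈log₂ n ⌉                    ∎
      where
      open ≤-Reasoning
      half : ⌈ n /2⌉ ≤ 2 ^ (⌈log₂ n ⌉ ∸ 1)
      half = subst (λ k → ⌈ n /2⌉ ≤ 2 ^ k) (⌈log₂⌈n/2⌉⌉≡⌈log₂n⌉∸1 n) (rec (⌈n/2⌉<n m))

  ≤2^bits : ∀ n → n ≤ 2 ^ bits n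
  ≤2^bits n = ≤-trans (n≤1+n n) (n≤2^⌈log₂n⌉ (suc n))

  bits-≤ : ∀ {k w} → k ≤ 2 ^ w → bits k ≤ suc w
  bits-≤ {k} {w} k≤ = ≤-trans (⌈log₂⌉-mono-≤ (begin
      suc k           ≡⟨ +-comm 1 k ⟩
      k + 1           ≤⟨ +-mono-≤ k≤ (m^n>0 2 w) ⟩
      2 ^ w + 2 ^ w   ≡⟨ cong (λ j → 2 ^ w + j) (sym (+-identityʳ (2 ^ w))) ⟩
      2 ^ suc w       ∎))
    (≤-reflexive (⌈log₂2^n⌉≡n (suc w)))
    where open ≤-Reasoning

  num den : Label → ℕ
  num p = ∣ ↥ value p ∣
  den p = ↧ₙ (value p)

  num≤den : ∀ p → num p ≤ den p
  num≤den (label (mkℚᵘ (ℤ.+ a) d)      _        (*≤* le)) = ℤ.drop‿+≤+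
    (subst₂ ℤ._≤_ (ℤ.*-identityʳ (ℤ.+ a)) (ℤ.*-identityˡ (ℤ.+ suc d)) le)
  num≤den (label (mkℚᵘ ℤ.-[1+ _ ] _) (*≤* ()) _)

  encodeLabel : Label → Val
  encodeLabel p = encodeℚ (value p)

  encode-average : ∀ p q → encodeLabel (averageLabel p q) ≡
    ⟪ nat (num p * den q + num q * den p) , nat (2 * (den p * den q)) ⟫
  encode-average (label (mkℚᵘ (ℤ.+ a) d) _ _) (label (mkℚᵘ (ℤ.+ b) e) _ _) =
    cong (λ k → ⟪ nat k , nat (2 * (suc d * suc e)) ⟫)
      (cong ∣_∣ (trans (ℤ.*-identityˡ _) (cong₂ ℤ._+_ (sym (ℤ.pos-* a (suc e))) (sym (ℤ.pos-* b (suc d))))))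
  encode-average (label (mkℚᵘ ℤ.-[1+ _ ] _) (*≤* ()) _) _
  encode-average (label (mkℚᵘ (ℤ.+ _) _) _ _) (label (mkℚᵘ ℤ.-[1+ _ ] _) (*≤* ()) _)

  encode-square : ∀ p → encodeLabel (squareLabel p) ≡ ⟪ nat (num p * num p) , nat (den p * den p) ⟫
  encode-square (label p@record{} _ _) =
    cong (λ k → ⟪ nat k , nat (↧ₙ p * ↧ₙ p) ⟫) (ℤ.abs-* (↥ p) (↥ p))

  den-average : ∀ p q → den (averageLabel p q) ≡ 2 * (den p * den q)
  den-average (label p@record{} _ _) (label q@record{} _ _) = refl

  den-square : ∀ p → den (squareLabel p) ≡ den p * den p
  den-square (label p@record{} _ _) = refl

  -- Labels lie in [0,1], so the denominator also bounds the numerator.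
  Width : ℕ → Label → Set
  Width w p = den p ≤ 2 ^ w

  width-≤ : ∀ w w′ p → w ≤ w′ → Width w p → Width w′ p
  width-≤ w w′ p w≤ le = ≤-trans le (^-monoʳ-≤ 2 w≤)

  *-width : ∀ {a b} v w → a ≤ 2 ^ v → b ≤ 2 ^ w → a * b ≤ 2 ^ (v + w)
  *-width v w p q = ≤-trans (*-mono-≤ p q) (≤-reflexive (sym (^-distribˡ-+-* 2 v w)))

  average-width : ∀ v w p q → Width v p → Width w q → Width (suc (v + w)) (averageLabel p q)
  average-width v w p q vp wq =
    ≤-trans (≤-reflexive (den-average p q)) (*-monoʳ-≤ 2 (*-width v w vp wq))

  square-width : ∀ w p → Width w p → Width (w + w) (squareLabel p)
  square-width w p wp = ≤-trans (≤-reflexive (den-square p)) (*-width w w wp wp)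

  num-width : ∀ w p → Width w p → num p ≤ 2 ^ w
  num-width w p = ≤-trans (num≤den p)

  mulCost : ∀ {a b} v w → a ≤ 2 ^ v → b ≤ 2 ^ w → opCost mul a b ≤ 3 * suc (v + w)
  mulCost v w p q = ≤-trans (s≤s (≤-trans (+-mono-≤ (bits-≤ p) (bits-≤ q))
                                                  (≤-reflexive (cong suc (+-suc v w)))))
    (≤-trans (m≤m+n (3 + (v + w)) (2 * (v + w)))
             (≤-reflexive (solve 1 (λ s → con 3 :+ s :+ con 2 :* s := con 3 :* (con 1 :+ s)) refl (v + w))))

  -- `Total Y xs κ e` bounds the sum of xs by κ·Y + e: items are charged to multiples of
  -- one unit Y, while extras, such as the costs of recursive calls, are kept.
  data Total (Y : ℕ) : List ℕ → ℕ → ℕ → Set where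
    []    : Total Y [] 0 0
    item  : ∀ κ {x xs κs e} → x ≤ κ * Y → Total Y xs κs e → Total Y (x ∷ xs) (κ + κs) e
    extra : ∀ {x xs κs u e} → x ≤ u → Total Y xs κs e → Total Y (x ∷ xs) κs (u + e)

  total : ∀ {Y xs κ e} → Total Y xs κ e → sum xs ≤ κ * Y + e
  total []                          = z≤n
  total {Y} (item κ {x} {xs} {κs} {e} p ps) = begin
    x + sum xs               ≤⟨ +-mono-≤ p (total ps) ⟩
    κ * Y + (κs * Y + e)     ≡⟨ solve 4 (λ κ κs Y e → κ :* Y :+ (κs :* Y :+ e) := (κ :+ κs) :* Y :+ e) refl κ κs Y e ⟩
    (κ + κs) * Y + e         ∎
    where open ≤-Reasoning
  total {Y} (extra {x} {xs} {κs} {u} {e} p ps) = begin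
    x + sum xs               ≤⟨ +-mono-≤ p (total ps) ⟩
    u + (κs * Y + e)         ≡⟨ solve 3 (λ u k e → u :+ (k :+ e) := k :+ (u :+ e)) refl u (κs * Y) e ⟩
    κs * Y + (u + e)         ∎
    where open ≤-Reasoning

  computes-total : ∀ {f u v v′ c xs κ′ e} Y κ → 1 ≤ Y → Runs (u ∷ []) (program f) v c xs → v ≡ v′ →
                   Total Y xs κ′ e → {_ : T (c + κ′ ≤ᵇ κ)} → Computes f u v′ (κ * Y + e)
  computes-total {c = c} {xs} {κ′} {e} Y κ 1≤Y r eq ps {c+κ′≤κ} = computes r eq (begin
      c + sum xs               ≤⟨ +-mono-≤ (≤-trans (≤-reflexive (sym (*-identityʳ c))) (*-monoʳ-≤ c 1≤Y)) (total ps) ⟩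
      c * Y + (κ′ * Y + e)     ≡⟨ solve 4 (λ κ κs Y e → κ :* Y :+ (κs :* Y :+ e) := (κ :+ κs) :* Y :+ e) refl c κ′ Y e ⟩
      (c + κ′) * Y + e         ≤⟨ +-monoˡ-≤ e (*-monoˡ-≤ Y (≤ᵇ⇒≤ (c + κ′) κ c+κ′≤κ)) ⟩
      κ * Y + e                ∎)
    where open ≤-Reasoning

  computes-within : ∀ {f u v v′ c xs κ′ e O} Y κ → 1 ≤ Y → κ * Y ≤ O → Runs (u ∷ []) (program f) v c xs → v ≡ v′ →
                    Total Y xs κ′ e → {_ : T (c + κ′ ≤ᵇ κ)} → Computes f u v′ (O + e)
  computes-within {e = e} Y κ 1≤Y κY≤O r eq ps {p} with computes-total Y κ 1≤Y r eq ps {p}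
  ... | d ▹ le = d ▹ ≤-trans le (+-monoˡ-≤ e κY≤O)

  slower : ∀ {f u v b b′} → b ≤ b′ → Computes f u v b → Computes f u v b′
  slower le (p ▹ t≤) = p ▹ ≤-trans t≤ le

  exactly : ∀ {f u v b} → Computes f u v (b + 0) → Computes f u v b
  exactly = slower (≤-reflexive (+-identityʳ _))

  average-computes : ∀ v w p q → Width v p → Width w q →
    Computes averageᶠ ⟪ encodeLabel p , encodeLabel q ⟫ (encodeLabel (averageLabel p q)) (64 * suc (v + w))
  average-computes v w p q vp wq = exactly (computes-total Y 64 (s≤s z≤n)
    (caseᵖ varʳ (caseᵖ varʳ (caseᵖ varʳ
      (pairʳ (addʳ (mulʳ (3 * Y) (mulCost v w (num-width v p vp) wq) varʳ varʳ)
                   (mulʳ (3 * suc (w + v)) (mulCost w v (num-width w q wq) vp) varʳ varʳ))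
             (mulʳ (6 * Y) (≤-trans (mulCost 1 (v + w) (≤-refl {2}) (*-width v w vp wq)) twice) natʳ
               (mulʳ (3 * Y) (mulCost v w vp wq) varʳ varʳ))))))
    (sym (encode-average p q))
    (item 3 ≤-refl (item 3 (≤-reflexive (cong (λ s → 3 * suc s) (+-comm w v))) (item 3 ≤-refl (item 6 ≤-refl [])))))
    where
    Y = suc (v + w)
    twice : 3 * suc (1 + (v + w)) ≤ 6 * Y
    twice = ≤-trans (m≤m+n _ (3 * (v + w)))
      (≤-reflexive (solve 1 (λ s → con 3 :* (con 2 :+ s) :+ con 3 :* s := con 6 :* (con 1 :+ s)) refl (v + w)))

  square-computes : ∀ w p → Width w p →
    Computes squareᶠ (encodeLabel p) (encodeLabel (squareLabel p)) (16 * suc (w + w))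
  square-computes w p wp = exactly (computes-total Y 16 (s≤s z≤n)
    (caseᵖ varʳ (pairʳ (mulʳ (3 * Y) (mulCost w w (num-width w p wp) (num-width w p wp)) varʳ varʳ)
                       (mulʳ (3 * Y) (mulCost w w wp wp) varʳ varʳ)))
    (sym (encode-square p))
    (item 3 ≤-refl (item 3 ≤-refl [])))
    where
    Y = suc (w + w)

  excess-computes : ∀ v w p q → Width v p → Width w q →
    Computes excessᶠ ⟪ encodeLabel p , encodeLabel q ⟫ (nat (excess p q)) (32 * suc (v + w))
  excess-computes v w p q vp wq = exactly (computes-total Y 32 (s≤s z≤n)
    (caseᵖ varʳ (caseᵖ varʳ (caseᵖ varʳ
      (monusʳ (mulʳ (3 * suc (w + v)) (mulCost w v (num-width w q wq) vp) varʳ varʳ)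
              (mulʳ (3 * Y) (mulCost v w (num-width v p vp) wq) varʳ varʳ)))))
    refl
    (item 3 (≤-reflexive (cong (λ s → 3 * suc s) (+-comm w v))) (item 3 ≤-refl [])))
    where
    Y = suc (v + w)

  bitCode : Bool → ℕ
  bitCode false = 1
  bitCode true  = 2

  answerCode : Maybe Bool → ℕ
  answerCode nothing  = 0
  answerCode (just b) = bitCode b

  encodePath : ∀ {n} → Path n → Val
  encodePath []            = nat 0
  encodePath ((i , b) ∷ π) = ⟪ ⟪ nat (toℕ i) , nat (bitCode b) ⟫ , encodePath π ⟫

  -- The program tests equality of numbers by the sum of the two truncated differences.
  distance≢0 : ∀ {i j} → i ≢ j → ∃[ d ] (i ∸ j) + (j ∸ i) ≡ suc d
  distance≢0 {i} {j} i≢j with (i ∸ j) + (j ∸ i) in eq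
  ... | suc d = d , refl
  ... | zero with () ← i≢j (≤-antisym (m∸n≡0⇒m≤n (m+n≡0⇒m≡0 (i ∸ j) eq))
                                      (m∸n≡0⇒m≤n (m+n≡0⇒n≡0 (i ∸ j) eq)))

  answer-computes : ∀ {n} (π : Path n) i →
    Computes answerᶠ ⟪ nat (toℕ i) , encodePath π ⟫ (nat (answerCode (answer π i))) (64 * suc (length π))
  answer-computes []            i = exactly (computes-total 1 64 ≤-refl
    (caseᵖ varʳ (caseⁿ varʳ natʳ)) refl [])
  answer-computes ((j , b) ∷ π) i = slower (≤-reflexive (trans (cong (λ k → 64 * 1 + k) (+-identityʳ B))
                                                               (sym (*-suc 64 (suc (length π))))))
                                           computed
    where
    B = 64 * suc (length π)
    computed : Computes answerᶠ ⟪ nat (toℕ i) , encodePath ((j , b) ∷ π) ⟫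
                        (nat (answerCode (answer ((j , b) ∷ π) i))) (64 * 1 + (B + 0))
    computed with answer π i | answer-computes π i
    ... | just c | recursion = computes-total 1 64 ≤-refl
      (caseᵖ varʳ (caseᵖ varʳ (letʳ (callʳ (pairʳ varʳ varʳ) recursion) (found c)))) refl (extra ≤-refl [])
      where
      found : ∀ c {h ρ} → Runs (nat (bitCode c) ∷ ρ) (if0 v0 h v0) (nat (bitCode c)) 3 []
      found false = if0ˢ varʳ varʳ
      found true  = if0ˢ varʳ varʳ
    ... | nothing | recursion with i ≟ j
    ...   | yes refl = computes-total 1 64 ≤-refl
      (caseᵖ varʳ (caseᵖ varʳ (letʳ (callʳ (pairʳ varʳ varʳ) recursion)
        (if0ᶻ varʳ (caseᵖ varʳ (if0ᶻ (castʳ (cong nat same) (addʳ (monusʳ varʳ varʳ) (monusʳ varʳ varʳ))) varʳ)))))) refl (extra ≤-refl [])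
      where
      same : (toℕ i ∸ toℕ i) + (toℕ i ∸ toℕ i) ≡ 0
      same = cong₂ _+_ (n∸n≡0 (toℕ i)) (n∸n≡0 (toℕ i))
    ...   | no i≢j = computes-total 1 64 ≤-refl
      (caseᵖ varʳ (caseᵖ varʳ (letʳ (callʳ (pairʳ varʳ varʳ) recursion)
        (if0ᶻ varʳ (caseᵖ varʳ (if0ˢ (castʳ (cong nat (proj₂ (distance≢0 (λ eq → i≢j (toℕ-injective eq))))) (addʳ (monusʳ varʳ varʳ) (monusʳ varʳ varʳ))) natʳ)))))) refl (extra ≤-refl [])

  treeSize : ∀ {n} → RDT n → ℕ
  treeSize T = size (encode T)

  treeSize-decision : ∀ {n} i (t₀ t₁ : RDT n) → suc (treeSize t₀ + treeSize t₁) ≤ treeSize (decision i t₀ t₁)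
  treeSize-decision i t₀ t₁ =
    ≤-trans (m≤n+m _ (size (nat (toℕ i)))) (≤-trans (n≤1+n _) (≤-trans (m≤n+m _ (size (nat 1))) (n≤1+n _)))

  treeSize-stochastic : ∀ {n} (t₀ t₁ : RDT n) → suc (treeSize t₀ + treeSize t₁) ≤ treeSize (stochastic t₀ t₁)
  treeSize-stochastic t₀ t₁ = ≤-trans (m≤n+m _ (size (nat 2))) (n≤1+n _)

  left< : ∀ {a b s} → suc (a + b) ≤ s → suc a ≤ s
  left< {a} {b} p = ≤-trans (s≤s (m≤m+n a b)) p

  right< : ∀ {a b s} → suc (a + b) ≤ s → suc b ≤ s
  right< {a} {b} p = ≤-trans (s≤s (m≤n+m b a)) p

  1≤treeSize : ∀ {n} (T : RDT n) → 1 ≤ treeSize T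
  1≤treeSize (leaf _)         = s≤s z≤n
  1≤treeSize (decision _ _ _) = s≤s z≤n
  1≤treeSize (stochastic _ _) = s≤s z≤n

  -- An average adds the widths of its arguments and one bit, which matches the growth
  -- of `treeSize`; so widths stay proportional to the size of the tree.
  expect-width : ∀ {n} ω (g : Label → Path n → Label) → 1 ≤ ω →
                 (∀ v π → Width (ω * treeSize {n} (leaf v)) (g v π)) →
                 ∀ T π → Width (ω * treeSize T) (expect g T π)
  expect-width {n} ω g 1≤ω at-leaf = go
    where
    widen : ∀ {a b s} → suc (a + b) ≤ s → suc (ω * a + ω * b) ≤ ω * s
    widen {a} {b} {s} le = begin
      suc (ω * a + ω * b)    ≤⟨ +-monoˡ-≤ (ω * a + ω * b) 1≤ω ⟩
      ω + (ω * a + ω * b)    ≡⟨ solve 3 (λ ω a b → ω :+ (ω :* a :+ ω :* b) := ω :* (con 1 :+ (a :+ b))) refl ω a b ⟩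
      ω * suc (a + b)        ≤⟨ *-monoʳ-≤ ω le ⟩
      ω * s                  ∎
      where open ≤-Reasoning
    join : ∀ {a b s} p q → suc (a + b) ≤ s → Width (ω * a) p → Width (ω * b) q → Width (ω * s) (averageLabel p q)
    join {a} {b} {s} p q le wp wq =
      width-≤ (suc (ω * a + ω * b)) (ω * s) (averageLabel p q) (widen le) (average-width (ω * a) (ω * b) p q wp wq)
    go : ∀ T π → Width (ω * treeSize T) (expect g T π)
    go (leaf v) π = at-leaf v π
    go T@(decision i t₀ t₁) π with answer π i
    ... | nothing    = join (expect g t₀ π₀) (expect g t₁ π₁) (treeSize-decision i t₀ t₁) (go t₀ π₀) (go t₁ π₁)
      where π₀ π₁ : Path n
            π₀ = (i , false) ∷ π
            π₁ = (i , true) ∷ π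
    ... | just false = width-≤ (ω * treeSize t₀) (ω * treeSize T) (expect g t₀ π)
      (*-monoʳ-≤ ω (<⇒≤ (left< (treeSize-decision i t₀ t₁)))) (go t₀ π)
    ... | just true  = width-≤ (ω * treeSize t₁) (ω * treeSize T) (expect g t₁ π)
      (*-monoʳ-≤ ω (<⇒≤ (right< {treeSize t₀} (treeSize-decision i t₀ t₁)))) (go t₁ π)
    go (stochastic t₀ t₁) π =
      join (expect g t₀ π) (expect g t₁ π) (treeSize-stochastic t₀ t₁) (go t₀ π) (go t₁ π)

  leaf-width : ∀ {n} v → Width (1 * treeSize {n} (leaf v)) v
  leaf-width v = ≤-trans (≤2^bits (den v)) (^-monoʳ-≤ 2 (begin
      bits (den v)                                ≤⟨ n≤1+n _ ⟩
      size (nat (den v))                          ≤⟨ m≤n+m _ (size (nat (num v))) ⟩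
      size (nat (num v)) + size (nat (den v))     ≤⟨ m≤n+m _ 3 ⟩
      treeSize {0} (leaf v)                       ≡⟨ sym (+-identityʳ _) ⟩
      1 * treeSize {0} (leaf v)                   ∎))
    where open ≤-Reasoning

  mean-width : ∀ {n} (T : RDT n) π → Width (treeSize T) (mean T π)
  mean-width {n} T π = subst (λ w → Width w (mean T π)) (*-identityˡ (treeSize T))
    (expect-width 1 (λ v _ → v) ≤-refl (λ v _ → leaf-width {n} v) T π)

  -- A squared mean has twice the width of a mean, at every leaf of T.
  energy-width : ∀ {n} (R T : RDT n) π → Width ((treeSize R + treeSize R) * treeSize T) (energy R T π)
  energy-width {n} R = expect-width (treeSize R + treeSize R) (squaredMean R)
    (≤-trans (1≤treeSize R) (m≤m+n _ _))
    (λ v π → width-≤ (treeSize R + treeSize R) ((treeSize R + treeSize R) * treeSize {n} (leaf v)) (squaredMean R v π)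
      (≤-trans (≤-reflexive (sym (*-identityʳ _))) (*-monoʳ-≤ (treeSize R + treeSize R) (1≤treeSize {n} (leaf v))))
      (square-width (treeSize R) (mean R π) (mean-width R π)))

  module _ {n} (M : Val) (g : Label → Path n → Label) (ω S L Y κ : ℕ)
    (1≤ω : 1 ≤ ω)
    (g-width : ∀ v π → Width (ω * treeSize {n} (leaf v)) (g v π))
    (at-leaf : ∀ v π → length π ≤ L →
       Computes expectᶠ ⟪ encode {n} (leaf v) , ⟪ M , encodePath π ⟫ ⟫ (encodeLabel (g v π)) (κ * Y))
    (L<Y : suc L ≤ Y) (ωS<Y : suc (ω * S) ≤ Y) (256≤κ : 256 ≤ κ)
    where

    private
      -- The price of one node, including the evaluation of g at a leaf
      B : ℕ
      B = κ * Y

      1≤Y : 1 ≤ Y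
      1≤Y = ≤-trans (s≤s z≤n) L<Y

      overhead : 256 * Y ≤ B
      overhead = *-monoˡ-≤ Y 256≤κ

      lookup-cost : ∀ (π : Path n) → length π ≤ L → 64 * suc (length π) ≤ 64 * Y
      lookup-cost π len = *-monoʳ-≤ 64 (≤-trans (s≤s len) L<Y)

      average-cost : ∀ {a b s} → suc (a + b) ≤ s → s ≤ S → 64 * suc (ω * a + ω * b) ≤ 64 * Y
      average-cost {a} {b} le s≤S = *-monoʳ-≤ 64 (≤-trans (s≤s (begin
        ω * a + ω * b    ≡⟨ sym (*-distribˡ-+ ω a b) ⟩
        ω * (a + b)      ≤⟨ *-monoʳ-≤ ω (≤-trans (<⇒≤ le) s≤S) ⟩
        ω * S            ∎)) ωS<Y)
        where open ≤-Reasoning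

      both : ∀ {a b s} → suc (a + b) ≤ s → 256 * Y + (a * B + (b * B + 0)) ≤ s * B
      both {a} {b} {s} le = begin
        256 * Y + (a * B + (b * B + 0))    ≤⟨ +-monoˡ-≤ _ overhead ⟩
        B + (a * B + (b * B + 0))          ≡⟨ solve 3 (λ a b B → B :+ (a :* B :+ (b :* B :+ con 0)) := (con 1 :+ (a :+ b)) :* B) refl a b B ⟩
        suc (a + b) * B                    ≤⟨ *-monoˡ-≤ B le ⟩
        s * B                              ∎
        where open ≤-Reasoning

      one : ∀ {a s} → suc a ≤ s → 256 * Y + (a * B + 0) ≤ s * B
      one {a} {s} le = ≤-trans (+-mono-≤ overhead (≤-reflexive (+-identityʳ (a * B)))) (*-monoˡ-≤ B le)

    -- Each node pays B for itself, so the time is at most B per node of T.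
    expect-computes : ∀ T π → treeSize T ≤ S → length π + treeSize T ≤ L →
      Computes expectᶠ ⟪ encode T , ⟪ M , encodePath π ⟫ ⟫ (encodeLabel (expect g T π)) (treeSize T * B)
    expect-computes (leaf v) π s≤S len = slower
      (≤-trans (≤-reflexive (sym (*-identityˡ B))) (*-monoˡ-≤ B (1≤treeSize {n} (leaf v))))
      (at-leaf v π (m+n≤o⇒m≤o _ len))
    expect-computes T@(decision i t₀ t₁) π s≤S len with answer π i | answer-computes π i
    ... | nothing | lookup = slower (both {treeSize t₀} {treeSize t₁} smaller) (computes-total Y 256 1≤Y
      (caseᵖ varʳ (caseᵖ varʳ (caseᵖ varʳ (if0ˢ varʳ (if0ᶻ (monusʳ varʳ natʳ) (caseᵖ varʳ (caseᵖ varʳ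
        (letʳ (callʳ (pairʳ varʳ varʳ) lookup) (if0ᶻ varʳ
          (callʳ (pairʳ (callʳ (tripleʳ varʳ varʳ (pairʳ (pairʳ varʳ natʳ) varʳ))
                               (expect-computes t₀ π₀ (≤-trans (<⇒≤ s₀) s≤S) (grow s₀)))
                        (callʳ (tripleʳ varʳ varʳ (pairʳ (pairʳ varʳ natʳ) varʳ))
                               (expect-computes t₁ π₁ (≤-trans (<⇒≤ s₁) s≤S) (grow s₁))))
                 (average-computes (ω * treeSize t₀) (ω * treeSize t₁) (expect g t₀ π₀) (expect g t₁ π₁)
                   (expect-width ω g 1≤ω g-width t₀ π₀) (expect-width ω g 1≤ω g-width t₁ π₁))))))))))))
      refl
      (item 64 (lookup-cost π (m+n≤o⇒m≤o _ len)) (extra ≤-refl (extra ≤-refl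
        (item 64 (average-cost smaller s≤S) [])))))
      where
      π₀ π₁ : Path n
      π₀ = (i , false) ∷ π
      π₁ = (i , true) ∷ π
      smaller = treeSize-decision i t₀ t₁
      s₀ = left< smaller
      s₁ = right< {treeSize t₀} smaller
      grow : ∀ {a} → suc a ≤ treeSize T → suc (length π) + a ≤ L
      grow {a} le = ≤-trans (≤-reflexive (sym (+-suc (length π) a))) (≤-trans (+-monoʳ-≤ (length π) le) len)
    ... | just false | lookup = slower (one s₀) (computes-total Y 256 1≤Y
      (caseᵖ varʳ (caseᵖ varʳ (caseᵖ varʳ (if0ˢ varʳ (if0ᶻ (monusʳ varʳ natʳ) (caseᵖ varʳ (caseᵖ varʳ
        (letʳ (callʳ (pairʳ varʳ varʳ) lookup) (if0ˢ varʳ (if0ᶻ (monusʳ varʳ natʳ)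
          (callʳ (tripleʳ varʳ varʳ varʳ)
            (expect-computes t₀ π (≤-trans (<⇒≤ s₀) s≤S) (≤-trans (+-monoʳ-≤ (length π) (<⇒≤ s₀)) len)))))))))))))
      refl
      (item 64 (lookup-cost π (m+n≤o⇒m≤o _ len)) (extra ≤-refl [])))
      where s₀ = left< (treeSize-decision i t₀ t₁)
    ... | just true | lookup = slower (one s₁) (computes-total Y 256 1≤Y
      (caseᵖ varʳ (caseᵖ varʳ (caseᵖ varʳ (if0ˢ varʳ (if0ᶻ (monusʳ varʳ natʳ) (caseᵖ varʳ (caseᵖ varʳ
        (letʳ (callʳ (pairʳ varʳ varʳ) lookup) (if0ˢ varʳ (if0ˢ (monusʳ varʳ natʳ)
          (callʳ (tripleʳ varʳ varʳ varʳ)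
            (expect-computes t₁ π (≤-trans (<⇒≤ s₁) s≤S) (≤-trans (+-monoʳ-≤ (length π) (<⇒≤ s₁)) len)))))))))))))
      refl
      (item 64 (lookup-cost π (m+n≤o⇒m≤o _ len)) (extra ≤-refl [])))
      where s₁ = right< {treeSize t₀} (treeSize-decision i t₀ t₁)
    expect-computes T@(stochastic t₀ t₁) π s≤S len = slower (both {treeSize t₀} {treeSize t₁} smaller) (computes-total Y 256 1≤Y
      (caseᵖ varʳ (caseᵖ varʳ (caseᵖ varʳ (if0ˢ varʳ (if0ˢ (monusʳ varʳ natʳ) (caseᵖ varʳ
        (callʳ (pairʳ (callʳ (tripleʳ varʳ varʳ varʳ) (expect-computes t₀ π (≤-trans (<⇒≤ s₀) s≤S) (shrink s₀)))
                      (callʳ (tripleʳ varʳ varʳ varʳ) (expect-computes t₁ π (≤-trans (<⇒≤ s₁) s≤S) (shrink s₁))))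
               (average-computes (ω * treeSize t₀) (ω * treeSize t₁) (expect g t₀ π) (expect g t₁ π)
                 (expect-width ω g 1≤ω g-width t₀ π) (expect-width ω g 1≤ω g-width t₁ π)))))))))
      refl
      (extra ≤-refl (extra ≤-refl (item 64 (average-cost smaller s≤S) []))))
      where
      smaller = treeSize-stochastic t₀ t₁
      s₀ = left< smaller
      s₁ = right< {treeSize t₀} smaller
      shrink : ∀ {a} → suc a ≤ treeSize T → length π + a ≤ L
      shrink le = ≤-trans (+-monoʳ-≤ (length π) (<⇒≤ le)) len

  mean-computes : ∀ {n} (T : RDT n) π Y → suc (length π + treeSize T) ≤ Y →
    Computes expectᶠ ⟪ encode T , ⟪ nat 0 , encodePath π ⟫ ⟫ (encodeLabel (mean T π)) (treeSize T * (256 * Y))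
  mean-computes {n} T π Y le = expect-computes (nat 0) (λ v _ → v) 1 (treeSize T) (length π + treeSize T) Y 256
    ≤-refl (λ v _ → leaf-width {n} v)
    (λ v π _ → exactly (computes-total Y 256 (≤-trans (s≤s z≤n) le)
      (caseᵖ varʳ (caseᵖ varʳ (caseᵖ varʳ (if0ᶻ varʳ (caseⁿ varʳ varʳ))))) refl []))
    le (≤-trans (s≤s (≤-trans (≤-reflexive (*-identityˡ (treeSize T))) (m≤n+m _ (length π)))) le) ≤-refl
    T π ≤-refl ≤-refl

  -- Distinguishes a tree from the number 0 in the argument M of `expectᵉ`.
  encode-pair : ∀ {n} (R : RDT n) → ∃[ a ] ∃[ b ] encode R ≡ ⟪ a , b ⟫
  encode-pair (leaf _)         = _ , _ , refl
  encode-pair (decision _ _ _) = _ , _ , refl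
  encode-pair (stochastic _ _) = _ , _ , refl

  module BuildCost {n} (R : RDT n) (Y : ℕ) where

    private
      N Z : ℕ
      N = treeSize R
      Z = Y * (Y * Y)

    -- Y bounds all lengths: a is the length of the path plus the sizes of the trees still
    -- to be traversed, an upper bound for the paths yet to occur, and N + N is the width
    -- of a squared mean.
    Room : ℕ → Set
    Room a = suc (a + (N + N)) ≤ Y

    module _ (NN<Y : suc (N + N) ≤ Y) where

      1≤Y : 1 ≤ Y
      1≤Y = ≤-trans (s≤s z≤n) NN<Y

      N≤Y : N ≤ Y
      N≤Y = ≤-trans (≤-trans (m≤m+n N N) (n≤1+n _)) NN<Y

      Y≤YY : Y ≤ Y * Y
      Y≤YY = ≤-trans (≤-reflexive (sym (*-identityˡ Y))) (*-monoˡ-≤ Y 1≤Y)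

      YY≤Z : Y * Y ≤ Z
      YY≤Z = *-monoʳ-≤ Y Y≤YY

      1≤YY : 1 ≤ Y * Y
      1≤YY = ≤-trans 1≤Y Y≤YY

      1≤Z : 1 ≤ Z
      1≤Z = ≤-trans 1≤YY YY≤Z

      -- The energy of a tree of size s has width 2Ns, below Y².
      energyWidth< : ∀ {s} → s ≤ Y → suc ((N + N) * s) ≤ Y * Y
      energyWidth< {s} s≤Y = begin
        suc ((N + N) * s)    ≤⟨ s≤s (*-monoʳ-≤ (N + N) s≤Y) ⟩
        1 + (N + N) * Y      ≤⟨ +-monoˡ-≤ _ 1≤Y ⟩
        suc (N + N) * Y      ≤⟨ *-monoˡ-≤ Y NN<Y ⟩
        Y * Y                ∎
        where open ≤-Reasoning

      absorb : ∀ s κ W → s ≤ Y → s * (κ * W) ≤ κ * (Y * W)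
      absorb s κ W s≤Y = ≤-trans (*-monoˡ-≤ (κ * W) s≤Y)
        (≤-reflexive (solve 3 (λ Y κ W → Y :* (κ :* W) := κ :* (Y :* W)) refl Y κ W))

      -- At most Y nodes, each at a price of order Y²: a mean takes N·O(Y) steps and the
      -- arithmetic works on O(Y²) bits.
      energy-computes : ∀ T π → Room (length π + treeSize T) →
        Computes expectᶠ ⟪ encode T , ⟪ encode R , encodePath π ⟫ ⟫ (encodeLabel (energy R T π)) (512 * Z)
      energy-computes T π room = slower (absorb (treeSize T) 512 (Y * Y) T≤Y)
        (expect-computes (encode R) (squaredMean R) (N + N) (treeSize T) (length π + treeSize T) (Y * Y) 512
          (≤-trans (1≤treeSize R) (m≤m+n N N))
          (λ v π → width-≤ (N + N) ((N + N) * treeSize {n} (leaf v)) (squaredMean R v π)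
            (≤-trans (≤-reflexive (sym (*-identityʳ (N + N)))) (*-monoʳ-≤ (N + N) (1≤treeSize {n} (leaf v))))
            (square-width N (mean R π) (mean-width R π)))
          at-leaf
          (≤-trans (s≤s (m≤m+n _ (N + N))) (≤-trans room Y≤YY))
          (energyWidth< T≤Y)
          (≤ᵇ⇒≤ 256 512 _) T π ≤-refl ≤-refl)
        where
        T≤Y : treeSize T ≤ Y
        T≤Y = ≤-trans (≤-trans (m≤n+m _ (length π)) (≤-trans (m≤m+n _ (N + N)) (n≤1+n _))) room
        at-leaf : ∀ v π′ → length π′ ≤ length π + treeSize T →
          Computes expectᶠ ⟪ encode {n} (leaf v) , ⟪ encode R , encodePath π′ ⟫ ⟫
                   (encodeLabel (squaredMean R v π′)) (512 * (Y * Y))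
        at-leaf v π′ len = exactly (computes-total (Y * Y) 512 1≤YY
          (caseᵖ varʳ (caseᵖ varʳ (caseᵖ varʳ (if0ᶻ varʳ (caseᵖ (castʳ (proj₂ (proj₂ (encode-pair R))) varʳ)
            (callʳ (callʳ (tripleʳ varʳ natʳ varʳ) (mean-computes R π′ Y here))
                   (square-computes N (mean R π′) (mean-width R π′))))))))
          refl
          (item 256 (absorb N 256 Y N≤Y) (item 16 (*-monoʳ-≤ 16 (≤-trans NN<Y Y≤YY)) [])))
          where
          here : suc (length π′ + N) ≤ Y
          here = ≤-trans (s≤s (+-mono-≤ len (m≤m+n N N))) room

      private
        q : ℕ
        q = queryComplexity R

      -- O is the time of one step outside its recursive calls, and B also pays for the part
      -- of the output written in this step.
      module _ (O B : ℕ) (2048Z≤O : 2048 * Z ≤ O) (O+8Z≤B : O + 8 * Z ≤ B) where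

        -- The output branches at most d + k·q times on a path, and at most s + k(N + 1) steps
        -- of the walk lie on a path.
        budget : ℕ → ℕ → ℕ → ℕ
        budget d s k = 2 ^ (d + k * q) * ((s + k * suc N) * B)

        -- A step with one recursive call is paid by the growth of the number of steps.
        grow-one : ∀ P h′ {h o} → o ≤ B → suc h′ ≤ h → o + 2 ^ P * (h′ * B) ≤ 2 ^ P * (h * B)
        grow-one P h′ {h} {o} o≤B h′<h = begin
          o + 2 ^ P * (h′ * B)              ≤⟨ +-monoˡ-≤ _ o≤B ⟩
          B + 2 ^ P * (h′ * B)              ≡⟨ cong (_+ 2 ^ P * (h′ * B)) (sym (*-identityˡ B)) ⟩
          1 * B + 2 ^ P * (h′ * B)          ≤⟨ +-monoˡ-≤ _ (*-monoˡ-≤ B (m^n>0 2 P)) ⟩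
          2 ^ P * B + 2 ^ P * (h′ * B)      ≡⟨ sym (*-distribˡ-+ (2 ^ P) B (h′ * B)) ⟩
          2 ^ P * (suc h′ * B)              ≤⟨ *-monoʳ-≤ (2 ^ P) (*-monoˡ-≤ B h′<h) ⟩
          2 ^ P * (h * B)                   ∎
          where open ≤-Reasoning

        -- A step with two recursive calls doubles the power of two.
        grow-two : ∀ P h′ {h o} → o ≤ B → suc h′ ≤ h →
                   o + (2 ^ P * (h′ * B) + 2 ^ P * (h′ * B)) ≤ 2 ^ suc P * (h * B)
        grow-two P h′ {h} {o} o≤B h′<h = ≤-trans (≤-reflexive (cong (o +_) (solve 2 (λ p x →
            p :* x :+ p :* x := (con 2 :* p) :* x) refl (2 ^ P) (h′ * B))))
          (grow-one (suc P) h′ o≤B h′<h)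

        budget-mono : ∀ {d d′ s s′} k → d ≤ d′ → s ≤ s′ → budget d s k ≤ 2 ^ (d′ + k * q) * ((s′ + k * suc N) * B)
        budget-mono k d≤ s≤ = *-mono-≤ (^-monoʳ-≤ 2 (+-monoˡ-≤ (k * q) d≤)) (*-monoˡ-≤ B (+-monoˡ-≤ (k * suc N) s≤))

        -- The size of the output is bounded together with the time, because both satisfy the
        -- same recursion.
        record Builds (T : RDT n) (k : ℕ) (π : Path n) (D : RDT n) (u : ℕ) : Set where
          constructor builds
          field
            cost     : ℕ
            computed : Computes buildᶠ ⟪ encode T , ⟪ ⟪ encode R , nat k ⟫ , encodePath π ⟫ ⟫
                                (encode D) cost
            total-≤  : cost + treeSize D ≤ u

        room-mono : ∀ {a b} → a ≤ b → Room b → Room a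
        room-mono a≤b = ≤-trans (s≤s (+-monoˡ-≤ (N + N) a≤b))

        leaf-size : ∀ w (p : Label) → Width w p → treeSize {n} (leaf p) ≤ 7 + (w + w)
        leaf-size w p wp = ≤-trans
          (+-monoʳ-≤ 3 (+-mono-≤ (s≤s (bits-≤ (num-width w p wp))) (s≤s (bits-≤ wp))))
          (≤-reflexive (solve 1 (λ w → con 3 :+ ((con 2 :+ w) :+ (con 2 :+ w)) := con 7 :+ (w :+ w)) refl w))

        small : ∀ {c} κ → c ≤ κ * Z → κ ≤ 8 → O + c ≤ B
        small κ c≤ κ≤8 = ≤-trans (+-monoʳ-≤ O (≤-trans c≤ (*-monoˡ-≤ Z κ≤8))) O+8Z≤B

        numeral-≤ : ∀ κ → κ ≤ κ * Z
        numeral-≤ κ = ≤-trans (≤-reflexive (sym (*-identityʳ κ))) (*-monoʳ-≤ κ 1≤Z)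

        overhead : O ≤ B
        overhead = ≤-trans (m≤m+n O (8 * Z)) O+8Z≤B

        step-one : ∀ {d s d′ s′ c o} k → d ≤ d′ → suc s ≤ s′ → c + o ≤ budget d s k →
                   (O + (c + 0)) + o ≤ budget d′ s′ k
        step-one {d} {s} {d′} {s′} {c} {o} k d≤ s< le = begin
          (O + (c + 0)) + o       ≡⟨ trans (cong (λ x → O + x + o) (+-identityʳ c)) (+-assoc O c o) ⟩
          O + (c + o)               ≤⟨ +-monoʳ-≤ O (≤-trans le (budget-mono k d≤ (≤-refl {s}))) ⟩
          O + budget d′ s k         ≤⟨ grow-one (d′ + k * q) (s + k * suc N) overhead (+-monoˡ-≤ (k * suc N) s<) ⟩
          budget d′ s′ k                   ∎
          where open ≤-Reasoning

        ≤Y : ∀ {a b} → Room (a + b) → a ≤ Y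
        ≤Y {a} {b} = ≤-trans (≤-trans (m≤m+n a b) (≤-trans (m≤m+n (a + b) (N + N)) (n≤1+n _)))

        lookup-cost : ∀ (π : Path n) {s a} → Room (length π + s + a) → 64 * suc (length π) ≤ 64 * Z
        lookup-cost π {s} {a} room = *-monoʳ-≤ 64 (≤-trans
          (≤-trans (s≤s (≤-trans (m≤m+n (length π) s) (≤-trans (m≤m+n _ a) (m≤m+n _ (N + N))))) room)
          (≤-trans Y≤YY YY≤Z))

        energy-room : ∀ (π : Path n) {a s b} → suc a ≤ s → Room (length π + s + b) → Room (length π + a)
        energy-room π a< = room-mono (≤-trans (+-monoʳ-≤ (length π) (<⇒≤ a<)) (m≤m+n _ _))

        compare-cost : ∀ (π : Path n) {s₀ s₁ s b} → suc (s₀ + s₁) ≤ s → Room (length π + s + b) →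
                       32 * suc ((N + N) * s₀ + (N + N) * s₁) ≤ 32 * Z
        compare-cost π {s₀} {s₁} {s} {b} le room = *-monoʳ-≤ 32 (begin
          suc ((N + N) * s₀ + (N + N) * s₁)    ≡⟨ cong suc (sym (*-distribˡ-+ (N + N) s₀ s₁)) ⟩
          suc ((N + N) * (s₀ + s₁))            ≤⟨ energyWidth< (≤-trans (<⇒≤ le) (≤-trans (m≤n+m s (length π)) (≤Y {length π + s} {b} room))) ⟩
          Y * Y                                ≤⟨ YY≤Z ⟩
          Z                                    ∎)
          where open ≤-Reasoning

        below : ∀ l {a s b} → suc a ≤ s → l + a + b ≤ l + s + b
        below l a< = +-monoˡ-≤ _ (+-monoʳ-≤ l (<⇒≤ a<))

        below-asked : ∀ l {a s b} → suc a ≤ s → suc l + a + b ≤ l + s + b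
        below-asked l {a} a< = +-monoˡ-≤ _ (≤-trans (≤-reflexive (sym (+-suc l a))) (+-monoʳ-≤ l a<))

        -- The outcome m of the comparison is a parameter, so that the two choices are two
        -- clauses.
        build-stochastic : ∀ t₀ t₁ k π m D₀ D₁ {e₀ e₁ x} →
          e₀ ≤ 512 * Z → e₁ ≤ 512 * Z → x ≤ 32 * Z →
          Computes expectᶠ ⟪ encode t₀ , ⟪ encode R , encodePath π ⟫ ⟫ (encodeLabel (energy R t₀ π)) e₀ →
          Computes expectᶠ ⟪ encode t₁ , ⟪ encode R , encodePath π ⟫ ⟫ (encodeLabel (energy R t₁ π)) e₁ →
          Computes excessᶠ ⟪ encodeLabel (energy R t₀ π) , encodeLabel (energy R t₁ π) ⟫ (nat m) x →
          Builds t₀ k π D₀ (budget (queryComplexity t₀) (treeSize t₀) k) →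
          Builds t₁ k π D₁ (budget (queryComplexity t₁) (treeSize t₁) k) →
          Builds (stochastic t₀ t₁) k π (choose m D₀ D₁)
                 (budget (queryComplexity (stochastic t₀ t₁)) (treeSize (stochastic t₀ t₁)) k)
        build-stochastic t₀ t₁ k π zero _ _ e₀≤ e₁≤ x≤ run₀ run₁ compare (builds c rec le) _ = builds (O + (c + 0))
          (computes-within Z 2048 1≤Z 2048Z≤O
            (caseᵖ varʳ (caseᵖ varʳ (caseᵖ varʳ (if0ˢ varʳ (if0ˢ (monusʳ varʳ natʳ) (caseᵖ varʳ (caseᵖ varʳ
              (if0ᶻ (callʳ (pairʳ (callʳ (tripleʳ varʳ varʳ varʳ) run₀)
                                  (callʳ (tripleʳ varʳ varʳ varʳ) run₁)) compare)
                (callʳ (tripleʳ varʳ varʳ varʳ) rec)))))))))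
            refl (item 512 e₀≤ (item 512 e₁≤ (item 32 x≤ (extra ≤-refl [])))))
          (step-one {s = treeSize t₀} k (m≤m⊔n (queryComplexity t₀) (queryComplexity t₁)) (left< (treeSize-stochastic t₀ t₁)) le)
        build-stochastic t₀ t₁ k π (suc _) _ _ e₀≤ e₁≤ x≤ run₀ run₁ compare _ (builds c rec le) = builds (O + (c + 0))
          (computes-within Z 2048 1≤Z 2048Z≤O
            (caseᵖ varʳ (caseᵖ varʳ (caseᵖ varʳ (if0ˢ varʳ (if0ˢ (monusʳ varʳ natʳ) (caseᵖ varʳ (caseᵖ varʳ
              (if0ˢ (callʳ (pairʳ (callʳ (tripleʳ varʳ varʳ varʳ) run₀)
                                  (callʳ (tripleʳ varʳ varʳ varʳ) run₁)) compare)
                (callʳ (tripleʳ varʳ varʳ varʳ) rec)))))))))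
            refl (item 512 e₀≤ (item 512 e₁≤ (item 32 x≤ (extra ≤-refl [])))))
          (step-one {s = treeSize t₁} k (m≤n⊔m (queryComplexity t₀) (queryComplexity t₁)) (right< {treeSize t₀} (treeSize-stochastic t₀ t₁)) le)

        build-computes : ∀ T k π → Room (length π + treeSize T + k * N) →
                         Builds T k π (build R T k π) (budget (queryComplexity T) (treeSize T) k)
        build-computes (leaf v) zero π room = builds O
          (exactly (computes-within Z 2048 1≤Z 2048Z≤O
            (caseᵖ varʳ (caseᵖ varʳ (caseᵖ varʳ (if0ᶻ varʳ (caseᵖ varʳ (if0ᶻ varʳ
              (pairʳ natʳ (callʳ (tripleʳ varʳ natʳ varʳ) (mean-computes R π Y here)))))))))
            refl (item 256 (≤-trans (absorb N 256 Y N≤Y) (*-monoʳ-≤ 256 YY≤Z)) [])))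
          (≤-trans (small 8 out ≤-refl)
            (≤-trans (m≤m+n B (1 * (0 * B))) (grow-one 0 0 ≤-refl
              (≤-trans (1≤treeSize {n} (leaf v)) (m≤m+n _ 0)))))
          where
          here : suc (length π + N) ≤ Y
          here = ≤-trans (s≤s (+-mono-≤ (≤-trans (m≤m+n (length π) _) (m≤m+n _ 0)) (m≤m+n N N))) room
          out : treeSize {n} (leaf (mean R π)) ≤ 8 * Z
          out = begin
            treeSize {n} (leaf (mean R π))    ≤⟨ leaf-size N (mean R π) (mean-width R π) ⟩
            7 + (N + N)                       ≤⟨ +-mono-≤ (numeral-≤ 7) (≤-trans (n≤1+n _) (≤-trans NN<Y (≤-trans Y≤YY YY≤Z))) ⟩
            7 * Z + Z                         ≡⟨ +-comm (7 * Z) Z ⟩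
            8 * Z                             ∎
            where open ≤-Reasoning
        build-computes (leaf v) (suc k) π room
          with builds c rec le ← build-computes R k π (room-mono
            (≤-trans (≤-reflexive (+-assoc (length π) N (k * N))) (+-monoˡ-≤ (N + k * N) (m≤m+n (length π) _))) room)
          = builds (O + (c + 0))
          (computes-within Z 2048 1≤Z 2048Z≤O
            (caseᵖ varʳ (caseᵖ varʳ (caseᵖ varʳ (if0ᶻ varʳ (caseᵖ varʳ (if0ˢ varʳ
              (callʳ (tripleʳ varʳ (pairʳ varʳ (monusʳ varʳ natʳ)) varʳ) rec)))))))
            refl (extra ≤-refl []))
          (begin
            (O + (c + 0)) + o               ≡⟨ trans (cong (λ x → O + x + o) (+-identityʳ c)) (+-assoc O c o) ⟩
            O + (c + o)                       ≤⟨ +-monoʳ-≤ O le ⟩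
            O + budget q N k                  ≤⟨ grow-one (q + k * q) (N + k * suc N) overhead (m≤n+m _ (treeSize {n} (leaf v))) ⟩
            budget 0 (treeSize {n} (leaf v)) (suc k) ∎)
          where
          open ≤-Reasoning
          o = treeSize (build R R k π)
        build-computes T@(decision i t₀ t₁) k π room with answer π i | answer-computes π i
        ... | nothing | lookup
          with builds c₀ rec₀ le₀ ← build-computes t₀ k ((i , false) ∷ π) (room-mono (below-asked (length π) (left< (treeSize-decision i t₀ t₁))) room)
             | builds c₁ rec₁ le₁ ← build-computes t₁ k ((i , true) ∷ π) (room-mono (below-asked (length π) (right< {treeSize t₀} (treeSize-decision i t₀ t₁))) room)
          = builds (O + (c₀ + (c₁ + 0)))
          (computes-within Z 2048 1≤Z 2048Z≤O
            (caseᵖ varʳ (caseᵖ varʳ (caseᵖ varʳ (if0ˢ varʳ (if0ᶻ (monusʳ varʳ natʳ) (caseᵖ varʳ (caseᵖ varʳ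
              (letʳ (callʳ (pairʳ varʳ varʳ) lookup) (if0ᶻ varʳ
                (pairʳ natʳ (tripleʳ varʳ (callʳ (tripleʳ varʳ varʳ (pairʳ (pairʳ varʳ natʳ) varʳ)) rec₀)
                                          (callʳ (tripleʳ varʳ varʳ (pairʳ (pairʳ varʳ natʳ) varʳ)) rec₁))))))))))))
            refl (item 64 (lookup-cost π room) (extra ≤-refl (extra ≤-refl []))))
          (begin
            (O + (c₀ + (c₁ + 0))) + (4 + (j + suc (d₀ + d₁)))
              ≡⟨ solve 6 (λ z c₀ c₁ j d₀ d₁ → (z :+ (c₀ :+ (c₁ :+ con 0))) :+ (con 4 :+ (j :+ (con 1 :+ (d₀ :+ d₁))))
                           := (z :+ (con 5 :+ j)) :+ ((c₀ :+ d₀) :+ (c₁ :+ d₁))) refl O c₀ c₁ j d₀ d₁ ⟩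
            (O + (5 + j)) + ((c₀ + d₀) + (c₁ + d₁))
              ≤⟨ +-mono-≤ (small 6 five+j (≤ᵇ⇒≤ 6 8 _))
                          (+-mono-≤ (≤-trans le₀ (budget-mono k (m≤m⊔n q₀ q₁) (m≤m+n s₀ s₁)))
                                    (≤-trans le₁ (budget-mono k (m≤n⊔m q₀ q₁) (m≤n+m s₁ s₀)))) ⟩
            B + (budget (q₀ ⊔ q₁) (s₀ + s₁) k + budget (q₀ ⊔ q₁) (s₀ + s₁) k)
              ≤⟨ grow-two (q₀ ⊔ q₁ + k * q) (s₀ + s₁ + k * suc N) ≤-refl (+-monoˡ-≤ (k * suc N) (treeSize-decision i t₀ t₁)) ⟩
            budget (suc (q₀ ⊔ q₁)) (treeSize T) k ∎)
          where
          open ≤-Reasoning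
          q₀ = queryComplexity t₀
          q₁ = queryComplexity t₁
          s₀ = treeSize t₀
          s₁ = treeSize t₁
          d₀ = treeSize (build R t₀ k ((i , false) ∷ π))
          d₁ = treeSize (build R t₁ k ((i , true) ∷ π))
          j = size (nat (toℕ i))
          five+j : 5 + j ≤ 6 * Z
          five+j = ≤-trans (+-mono-≤ (numeral-≤ 5) (≤-trans j≤Y (≤-trans Y≤YY YY≤Z))) (≤-reflexive (+-comm (5 * Z) Z))
            where
            j≤Y : j ≤ Y
            j≤Y = begin
              j                                     ≤⟨ m≤m+n j _ ⟩
              j + suc (s₀ + s₁)                     ≤⟨ m≤n+m _ 4 ⟩
              treeSize T                            ≤⟨ m≤n+m (treeSize T) (length π) ⟩
              length π + treeSize T                 ≤⟨ m≤m+n _ (k * N) ⟩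
              length π + treeSize T + k * N         ≤⟨ m≤m+n _ (N + N) ⟩
              length π + treeSize T + k * N + (N + N)  ≤⟨ n≤1+n _ ⟩
              suc (length π + treeSize T + k * N + (N + N)) ≤⟨ room ⟩
              Y                                     ∎
        ... | just false | lookup
          with builds c₀ rec₀ le₀ ← build-computes t₀ k π (room-mono (below (length π) (left< (treeSize-decision i t₀ t₁))) room)
          = builds (O + (c₀ + 0))
          (computes-within Z 2048 1≤Z 2048Z≤O
            (caseᵖ varʳ (caseᵖ varʳ (caseᵖ varʳ (if0ˢ varʳ (if0ᶻ (monusʳ varʳ natʳ) (caseᵖ varʳ (caseᵖ varʳ
              (letʳ (callʳ (pairʳ varʳ varʳ) lookup) (if0ˢ varʳ (if0ᶻ (monusʳ varʳ natʳ)
                (callʳ (tripleʳ varʳ varʳ varʳ) rec₀)))))))))))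
            refl (item 64 (lookup-cost π room) (extra ≤-refl [])))
          (step-one {s = treeSize t₀} k (m≤n⇒m≤1+n (m≤m⊔n (queryComplexity t₀) (queryComplexity t₁))) (left< (treeSize-decision i t₀ t₁)) le₀)
        ... | just true | lookup
          with builds c₁ rec₁ le₁ ← build-computes t₁ k π (room-mono (below (length π) (right< {treeSize t₀} (treeSize-decision i t₀ t₁))) room)
          = builds (O + (c₁ + 0))
          (computes-within Z 2048 1≤Z 2048Z≤O
            (caseᵖ varʳ (caseᵖ varʳ (caseᵖ varʳ (if0ˢ varʳ (if0ᶻ (monusʳ varʳ natʳ) (caseᵖ varʳ (caseᵖ varʳ
              (letʳ (callʳ (pairʳ varʳ varʳ) lookup) (if0ˢ varʳ (if0ˢ (monusʳ varʳ natʳ)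
                (callʳ (tripleʳ varʳ varʳ varʳ) rec₁)))))))))))
            refl (item 64 (lookup-cost π room) (extra ≤-refl [])))
          (step-one {s = treeSize t₁} k (m≤n⇒m≤1+n (m≤n⊔m (queryComplexity t₀) (queryComplexity t₁))) (right< {treeSize t₀} (treeSize-decision i t₀ t₁)) le₁)
        build-computes T@(stochastic t₀ t₁) k π room =
          build-stochastic t₀ t₁ k π (excess (energy R t₀ π) (energy R t₁ π)) (build R t₀ k π) (build R t₁ k π)
            ≤-refl ≤-refl (compare-cost π smaller room)
            (energy-computes t₀ π (energy-room π s₀ room)) (energy-computes t₁ π (energy-room π s₁ room))
            (excess-computes ((N + N) * treeSize t₀) ((N + N) * treeSize t₁) (energy R t₀ π) (energy R t₁ π)
                             (energy-width R t₀ π) (energy-width R t₁ π))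
            (build-computes t₀ k π (room-mono (below (length π) s₀) room))
            (build-computes t₁ k π (room-mono (below (length π) s₁) room))
          where
          smaller = treeSize-stochastic t₀ t₁
          s₀ = left< smaller
          s₁ = right< {treeSize t₀} smaller

  decisions-compute : ∀ {n} (T : RDT n) → Computes decisionsᶠ (encode T) (nat (decisionsSeen T)) (16 * treeSize T)
  decisions-compute {n} (leaf v) = slower (*-monoʳ-≤ 16 (1≤treeSize {n} (leaf v)))
    (exactly (computes-total 1 16 ≤-refl (caseᵖ varʳ (if0ᶻ varʳ natʳ)) refl []))
  decisions-compute T@(decision _ _ _) = slower (*-monoʳ-≤ 16 (1≤treeSize T))
    (exactly (computes-total 1 16 ≤-refl (caseᵖ varʳ (if0ˢ varʳ (if0ᶻ (monusʳ varʳ natʳ) natʳ))) refl []))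
  decisions-compute T@(stochastic t₀ t₁) = slower
    (≤-trans (≤-reflexive (solve 2 (λ a b → con 16 :+ (con 16 :* a :+ (con 16 :* b :+ con 0)) :=
                                            con 16 :* (con 1 :+ (a :+ b))) refl (treeSize t₀) (treeSize t₁)))
             (*-monoʳ-≤ 16 (treeSize-stochastic t₀ t₁)))
    (computes-total 1 16 ≤-refl
      (caseᵖ varʳ (if0ˢ varʳ (if0ˢ (monusʳ varʳ natʳ) (caseᵖ varʳ
        (addʳ (callʳ varʳ (decisions-compute t₀)) (callʳ varʳ (decisions-compute t₁)))))))
      refl (extra ≤-refl (extra ≤-refl [])))

  -- If a exceeds b, the remainder b ∸ a is cut off at 0, and k can only be 0.
  below-after-step : ∀ k a b → 1 ≤ b → k * a < (b ∸ a) + a → k * a < b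
  below-after-step k a b 1≤b upper with a ≤? b
  ... | yes a≤b = ≤-trans upper (≤-reflexive (m∸n+n≡m a≤b))
  ... | no a≰b  = ≤-trans (s≤s (≤-reflexive (cong (_* a) k≡0))) 1≤b
    where
    k≡0 : k ≡ 0
    k≡0 = n<1⇒n≡0 (*-cancelʳ-< a k 1 (≤-trans upper
      (≤-reflexive (trans (cong (_+ a) (m≤n⇒m∸n≡0 (<⇒≤ (≰⇒> a≰b)))) (sym (+-identityʳ a))))))

  -- The two bounds together say that k is ⌈b / a⌉.
  rounds-compute : ∀ a → 1 ≤ a → ∀ fuel b → b ≤ fuel →
    ∃[ k ] Computes roundsᶠ ⟪ nat a , nat b ⟫ (nat k) (16 * suc k) × b ≤ k * a × k * a < b + a
  rounds-compute a 1≤a fuel zero b≤ =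
    0 , exactly (computes-total 1 16 ≤-refl (caseᵖ varʳ (if0ᶻ varʳ natʳ)) refl []) , z≤n , 1≤a
  rounds-compute a 1≤a (suc fuel) b@(suc b′) (s≤s b≤)
    with k , run , lower , upper ← rounds-compute a 1≤a fuel (b ∸ a) (≤-trans (∸-monoʳ-≤ b 1≤a) b≤)
    = suc k
    , slower (≤-trans (≤-reflexive (cong (λ x → 16 + x) (+-identityʳ (16 * suc k)))) (≤-reflexive (sym (*-suc 16 (suc k)))))
        (computes-total 1 16 ≤-refl
          (caseᵖ varʳ (if0ˢ varʳ (addʳ natʳ (callʳ (pairʳ varʳ (monusʳ varʳ varʳ)) run)))) refl (extra ≤-refl []))
    , ≤-trans (m≤n+m∸n b a) (+-monoʳ-≤ a lower)
    , ≤-trans (≤-reflexive (sym (+-suc a (k * a)))) (≤-trans (+-monoʳ-≤ a (below-after-step k a b (s≤s z≤n) upper)) (≤-reflexive (+-comm a b)))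

  -- Brings the two branches of `roundsExp` to the same bound.
  relaxʳ : ∀ {n} {ρ : Vec Val n} {e v c xs d ys} → c + sum xs ≤ d + sum ys → Runs ρ e v c xs → Runs ρ e v d ys
  relaxʳ le (p ▹ t≤) = p ▹ ≤-trans t≤ le

  -- The number of rounds for ε = a / b: ⌈1/ε⌉, or 0 if R has no decision nodes.  In both
  -- cases it is at most itself times the query complexity, which is what allows
  -- factors polynomial in the number of rounds to be absorbed by 2^O(q/ε).
  record Plan {n} (R : RDT n) (a b : ℕ) : Set where
    field
      rounds   : ℕ
      -- 7 steps for the conditional, and the costs of both functions called in it.
      counting : ∀ {u v} → Runs (nat a ∷ nat b ∷ encode R ∷ u ∷ v ∷ []) roundsExp (nat rounds)
                                7 (16 * treeSize R ∷ 16 * suc rounds ∷ [])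
      useful   : rounds ≤ rounds * queryComplexity R
      few      : rounds * a ≤ 2 * b
      enough   : (decisionsSeen R ≡ 0 × rounds ≡ 0) ⊎ b ≤ rounds * a

  plan : ∀ {n} (R : RDT n) a b → 1 ≤ a → a ≤ b → Plan R a b
  plan R a b 1≤a a≤b with decisionsSeen R in eq | decisions-compute R
  ... | zero  | decided = record
    { rounds = 0
    ; counting = relaxʳ (+-mono-≤ (≤ᵇ⇒≤ 4 7 _) (+-monoʳ-≤ (16 * treeSize R) z≤n)) (if0ᶻ (callʳ varʳ decided) natʳ)
    ; useful = z≤n
    ; few    = z≤n
    ; enough = inj₁ (eq , refl)
    }
  ... | suc _ | decided with k , counted , lower , upper ← rounds-compute a 1≤a b b ≤-refl = record
    { rounds = k
    ; counting = if0ˢ (callʳ varʳ decided) (callʳ (pairʳ varʳ varʳ) counted)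
    ; useful = ≤-trans (≤-reflexive (sym (*-identityʳ k))) (*-monoʳ-≤ k (decisionsSeen-suc R eq))
    ; few    = ≤-trans (<⇒≤ upper) (≤-trans (+-monoʳ-≤ b a≤b) (≤-reflexive (cong (λ x → b + x) (sym (+-identityʳ b)))))
    ; enough = inj₂ lower
    }

  zeroLabel : Label
  zeroLabel = label 0ℚᵘ (ℚ.≤-refl {0ℚᵘ}) (*≤* (+≤+ z≤n))

  module _ {n} (R : RDT n) {a b} (p : Plan R a b) where
    open Plan p

    private
      N k X P : ℕ
      N = treeSize R
      k = rounds
      X = suc k * N
      P = 2 ^ (k * queryComplexity R)

      1≤N : 1 ≤ N
      1≤N = 1≤treeSize R

      N≤X : N ≤ X
      N≤X = m≤m+n N (k * N)

      1≤X : 1 ≤ X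
      1≤X = ≤-trans 1≤N N≤X

      k<X : suc k ≤ X
      k<X = ≤-trans (≤-reflexive (sym (*-identityʳ (suc k)))) (*-monoʳ-≤ (suc k) 1≤N)

    result : RDT n
    result = build R (leaf zeroLabel) k []

    -- The dummy leaf has size 6.
    room : ∀ ν → 9 ≤ ν → suc ((6 + k * N) + (N + N)) ≤ ν * X
    room ν 9≤ν = begin
      suc ((6 + k * N) + (N + N))   ≡⟨ solve 2 (λ kN N → con 7 :+ kN :+ (N :+ N) := con 7 :+ (N :+ (N :+ kN))) refl (k * N) N ⟩
      7 + (N + X)                   ≤⟨ +-mono-≤ (*-monoʳ-≤ 7 1≤X) (+-monoˡ-≤ X N≤X) ⟩
      7 * X + (X + X)               ≡⟨ solve 1 (λ X → con 7 :* X :+ (X :+ X) := con 9 :* X) refl X ⟩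
      9 * X                         ≤⟨ *-monoˡ-≤ X 9≤ν ⟩
      ν * X                         ∎
      where open ≤-Reasoning

    main-computes : ∀ {Y O B u} (NN<Y : suc (N + N) ≤ Y) (O≥ : 2048 * (Y * (Y * Y)) ≤ O) (B≥ : O + 8 * (Y * (Y * Y)) ≤ B) →
      BuildCost.Builds R Y NN<Y O B O≥ B≥ (leaf zeroLabel) k [] result u →
      ∃[ t ] Computes mainᶠ ⟪ encode R , ⟪ nat a , nat b ⟫ ⟫ (encode result) t ×
             t + size (encode result) ≤ 64 * X + u
    main-computes _ _ _ (BuildCost.builds c built total-≤)
      = 64 * X + (c + 0)
      , computes-total X 64 1≤X
          (caseᵖ varʳ (caseᵖ varʳ (callʳ (tripleʳ (tripleʳ natʳ natʳ natʳ) (pairʳ varʳ counting) natʳ) built)))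
          refl (item 16 (*-monoʳ-≤ 16 N≤X) (item 16 (*-monoʳ-≤ 16 k<X) (extra ≤-refl [])))
      , ≤-trans (≤-reflexive (trans (cong (λ x → 64 * X + x + size (encode result)) (+-identityʳ c))
                                    (+-assoc (64 * X) c (size (encode result)))))
                (+-monoʳ-≤ (64 * X) total-≤)

    -- ν scales the bound Y on all lengths, and κ the price of a step.
    main-bounded : ∀ ν κ → 9 ≤ ν → 2048 ≤ κ →
      let Y = ν * X in
      ∃[ t ] Computes mainᶠ ⟪ encode R , ⟪ nat a , nat b ⟫ ⟫ (encode result) t ×
             t + size (encode result) ≤
               64 * X + P * ((6 + k * suc N) * ((κ + 8) * (Y * (Y * Y))))
    main-bounded ν κ 9≤ν 2048≤κ = main-computes NN<Y O≥ B≥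
      (BuildCost.build-computes R Y NN<Y (κ * Z) ((κ + 8) * Z) O≥ B≥ (leaf zeroLabel) k [] (room ν 9≤ν))
      where
      Y Z : ℕ
      Y = ν * X
      Z = Y * (Y * Y)
      NN<Y : suc (N + N) ≤ Y
      NN<Y = ≤-trans (s≤s (m≤n+m (N + N) (6 + k * N))) (room ν 9≤ν)
      O≥ : 2048 * Z ≤ κ * Z
      O≥ = *-monoˡ-≤ Z 2048≤κ
      B≥ : κ * Z + 8 * Z ≤ (κ + 8) * Z
      B≥ = ≤-reflexive (sym (*-distribʳ-+ Z κ 8))

    6+k[1+N]≤8X : 6 + k * suc N ≤ 8 * X
    6+k[1+N]≤8X = begin
      6 + k * suc N       ≡⟨ cong (λ x → 6 + x) (*-suc k N) ⟩
      6 + (k + k * N)     ≤⟨ +-mono-≤ (*-monoʳ-≤ 6 1≤X) (+-mono-≤ (≤-trans (n≤1+n k) k<X) (m≤n+m (k * N) N)) ⟩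
      6 * X + (X + X)     ≡⟨ solve 1 (λ X → con 6 :* X :+ (X :+ X) := con 8 :* X) refl X ⟩
      8 * X               ∎
      where open ≤-Reasoning

    -- This is where a polynomial in the number k of rounds is absorbed: k + 1 ≤ 2^k ≤ 2^(kq).
    X⁴P≤ : X ^ 4 * P ≤ N ^ 4 * 2 ^ (5 * (k * queryComplexity R))
    X⁴P≤ = begin
      X ^ 4 * P
        ≡⟨ solve 3 (λ a N P → power (a :* N) :* P := power N :* (power a :* P)) refl (suc k) N P ⟩
      N ^ 4 * (suc k ^ 4 * P)          ≤⟨ *-monoʳ-≤ (N ^ 4) (*-monoˡ-≤ P (^-monoˡ-≤ 4 (≤-trans (n<2^n k) (^-monoʳ-≤ 2 useful)))) ⟩
      N ^ 4 * (P ^ 4 * P)              ≡⟨ cong (λ x → N ^ 4 * x) (trans (*-comm (P ^ 4) P)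
                                            (trans (^-*-assoc 2 (k * queryComplexity R) 5) (cong (2 ^_) (*-comm (k * queryComplexity R) 5)))) ⟩
      N ^ 4 * 2 ^ (5 * (k * queryComplexity R))   ∎
      where
      open ≤-Reasoning
      power : ∀ {m} → Polynomial m → Polynomial m
      power x = x :* (x :* (x :* (x :* con 1)))
      n<2^n : ∀ n → n < 2 ^ n
      n<2^n zero    = s≤s z≤n
      n<2^n (suc n) = +-mono-≤ (m^n>0 2 n) (≤-trans (n<2^n n) (≤-reflexive (sym (+-identityʳ (2 ^ n)))))

    main-time : ∀ ν κ → let Y = ν * X in
      64 * X + P * ((6 + k * suc N) * ((κ + 8) * (Y * (Y * Y)))) ≤
      (64 + 8 * ((κ + 8) * (ν * (ν * ν)))) * N ^ 4 * 2 ^ (5 * (k * queryComplexity R))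
    main-time ν κ = begin
      64 * X + P * ((6 + k * suc N) * (λ′ * (Y * (Y * Y))))
        ≤⟨ +-mono-≤ (*-monoʳ-≤ 64 X≤) (*-monoʳ-≤ P (*-monoˡ-≤ (λ′ * (Y * (Y * Y))) 6+k[1+N]≤8X)) ⟩
      64 * (X ^ 4 * P) + P * (8 * X * (λ′ * (Y * (Y * Y))))
        ≡⟨ solve 4 (λ X P ν l → con 64 :* ((X :* (X :* (X :* (X :* con 1)))) :* P) :+ P :* (con 8 :* X :* (l :* ((ν :* X) :* ((ν :* X) :* (ν :* X)))))
             := (con 64 :+ con 8 :* (l :* (ν :* (ν :* ν)))) :* ((X :* (X :* (X :* (X :* con 1)))) :* P)) refl X P ν λ′ ⟩
      C * (X ^ 4 * P)
        ≤⟨ *-monoʳ-≤ C X⁴P≤ ⟩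
      C * (N ^ 4 * 2 ^ (5 * (k * queryComplexity R)))
        ≡⟨ sym (*-assoc C (N ^ 4) _) ⟩
      C * N ^ 4 * 2 ^ (5 * (k * queryComplexity R)) ∎
      where
      open ≤-Reasoning
      λ′ Y C : ℕ
      λ′ = κ + 8
      Y = ν * X
      C = 64 + 8 * (λ′ * (ν * (ν * ν)))
      X≤ : X ≤ X ^ 4 * P
      X≤ = begin
        X               ≡⟨ sym (*-identityʳ X) ⟩
        X ^ 1           ≡⟨ sym (*-identityʳ (X ^ 1)) ⟩
        X ^ 1 * 1       ≤⟨ *-mono-≤ (^-monoʳ-≤ X ⦃ >-nonZero 1≤X ⦄ {1} {4} (s≤s z≤n)) (m^n>0 2 (k * queryComplexity R)) ⟩
        X ^ 4 * P       ∎

-- Time, queries and error in terms of ε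

module Assembly where

  open import Data.Integer as ℤ using (+_; +≤+)
  import Data.Integer.Properties as ℤ
  open import Data.List using ([])
  open import Data.Nat as ℕ using (ℕ; suc)
  import Data.Nat.Properties as ℕ
  open import Data.Nat.Solver
  open +-*-Solver using (solve; _:*_; _:=_; con)
  open import Data.Product using (∃-syntax; _×_; _,_)
  open import Data.Rational.Unnormalised
  open import Data.Rational.Unnormalised.Properties as ℚ using (≃-trans; ≃-sym)
  open import Data.Sum using (_⊎_; inj₁; inj₂)
  open import Relation.Binary.PropositionalEquality using (_≡_; refl; sym; trans; cong; subst; subst₂)
  open Expectation
  open Derandomization
  open Accuracy
  open Complexity
  open Plan

  product-≤ : ∀ e a m d → e ℕ.* a ℕ.≤ m ℕ.* suc d → (+ e / 1) * mkℚᵘ (+ a) d ≤ (+ m / 1)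
  product-≤ e a m d le = *≤* (subst₂ ℤ._≤_
    (trans (ℤ.pos-* e a) (sym (ℤ.*-identityʳ (+ e ℤ.* + a))))
    (trans (cong (λ x → + (m ℕ.* x)) (sym (ℕ.*-identityˡ (suc d)))) (ℤ.pos-* m (1 ℕ.* suc d)))
    (+≤+ le))

  1≤product : ∀ k a d → suc d ℕ.≤ k ℕ.* a → 1ℚᵘ ≤ (+ k / 1) * mkℚᵘ (+ a) d
  1≤product k a d le = *≤* (subst₂ ℤ._≤_
    (trans (cong +_ (sym (ℕ.*-identityˡ (suc d)))) (sym (ℤ.*-identityˡ (+ (1 ℕ.* suc d)))))
    (trans (ℤ.pos-* k a) (sym (ℤ.*-identityʳ (+ k ℤ.* + a))))
    (+≤+ le))

  numerator≤denominator : ∀ a d → mkℚᵘ (+ a) d < ½ → a ℕ.≤ suc d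
  numerator≤denominator a d (*<* lt) = ℕ.≤-trans (ℕ.m≤m*n a 2) (ℕ.<⇒≤ (ℤ.drop‿+<+
    (subst₂ ℤ._<_ (sym (ℤ.pos-* a 2)) (ℤ.*-identityˡ (+ suc d)) lt)))

  err : ∀ {n} (D : DDT n) (R : RDT n) → ℚᵘ
  err D R = 𝔼 (λ x → sq (⟦ D ⟧ᴰ x - 𝔼 (⟦ R ⟧ x)))

  -- On a deterministic tree and on R alike, the expected run is `sem`.
  err-sem : ∀ {n} (D : DDT n) (R : RDT n) → err D R ≃ error R (tree D) []
  err-sem D R = 𝔼-cong λ x → let p = ℚ.+-cong
                                       (𝔼-run (tree D) (noStochastic⇒randomness≤0 (noStochastic D)) x)
                                       (ℚ.-‿cong (𝔼-run R ℕ.≤-refl x))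
                             in ℚ.*-cong p p

  module _ {n} (R : RDT n) {a b} (p : Plan R a b) where

    output : DDT n
    output = ddt (result R p) (build-noStochastic R (leaf zeroLabel) (rounds p) [])

    output-queries : queryComplexity (result R p) ℕ.≤ rounds p ℕ.* queryComplexity R
    output-queries = build-queries R (leaf zeroLabel) (rounds p) []

  -- Without decision nodes f is constant and zero rounds are exact.
  output-error : ∀ {n} (R : RDT n) {a d} (p : Plan R a (suc d)) → err (output R p) R ≤ mkℚᵘ (+ a) d
  output-error {n} R {a} {d} p = ℚ.≤-respˡ-≃ (≃-sym (err-sem (output R p) R)) (bound (enough p))
    where
    ε = mkℚᵘ (+ a) d
    bound : (decisionsSeen R ≡ 0 × rounds p ≡ 0) ⊎ suc d ℕ.≤ rounds p ℕ.* a → error R (result R p) [] ≤ ε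
    bound (inj₂ lower) = error-≤ R zeroLabel (rounds p) (1≤product (rounds p) a d lower)
    bound (inj₁ (free , none)) = subst (λ k → error R (build R (leaf zeroLabel) k []) [] ≤ ε) (sym none)
      (ℚ.≤-respˡ-≃ (≃-sym (≃-trans (𝔼-cong exact) (𝔼-const {n} 0ℚᵘ))) (ℚ.nonNegative⁻¹ ε))
      where
      exact : ∀ x → sq (sem (leaf {n} (mean R [])) x - sem R x) ≃ 0ℚᵘ
      exact x = ≃-trans (ℚ.*-cong zero′ zero′) (*≡* refl)
        where zero′ = ℚ.p≃q⇒p-q≃0 (value (mean R [])) (sem R x) (≃-sym (decisionFree-constant R free [] x))

  RunsWithin : ℕ → Set
  RunsWithin c = ∀ {n} (R : RDT n) {a b} (p : Plan R a b) →
    ∃[ t ] Computes mainᶠ ⟪ encode R , ⟪ nat a , nat b ⟫ ⟫ (encode (result R p)) t ×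
           t ℕ.+ size (encode (result R p)) ℕ.≤
             c ℕ.* treeSize R ℕ.^ 4 ℕ.* 2 ℕ.^ (5 ℕ.* (rounds p ℕ.* queryComplexity R))

  -- 9 and 2048 are what the size of the initial call and the cost of one step require.
  polynomial-factor : ∀ ν κ → 9 ℕ.≤ ν → 2048 ℕ.≤ κ → ∃[ c ] RunsWithin c
  polynomial-factor ν κ 9≤ν 2048≤κ = 64 ℕ.+ 8 ℕ.* ((κ ℕ.+ 8) ℕ.* (ν ℕ.* (ν ℕ.* ν))) , λ R p →
    let t , computed , bound = main-bounded R p ν κ 9≤ν 2048≤κ
    in t , computed , ℕ.≤-trans bound (main-time R p ν κ)

  abstract
    main-guarantee : ∃[ c ] RunsWithin c
    main-guarantee = polynomial-factor 9 2048 ℕ.≤-refl ℕ.≤-refl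

  -- K·ε ≤ 2, so K rounds of q queries are at most 2q/ε queries.
  total-queries : ∀ {n} (R : RDT n) {a b} (p : Plan R a b) q → queryComplexity R ℕ.≤ q →
                  (rounds p ℕ.* queryComplexity R) ℕ.* a ℕ.≤ (2 ℕ.* q) ℕ.* b
  total-queries R {a} {b} p q R≤q = begin
    (k ℕ.* queryComplexity R) ℕ.* a    ≤⟨ ℕ.*-monoˡ-≤ a (ℕ.*-monoʳ-≤ k R≤q) ⟩
    (k ℕ.* q) ℕ.* a                    ≡⟨ solve 3 (λ k q a → k :* q :* a := q :* (k :* a)) refl k q a ⟩
    q ℕ.* (k ℕ.* a)                    ≤⟨ ℕ.*-monoʳ-≤ q (few p) ⟩
    q ℕ.* (2 ℕ.* b)                    ≡⟨ solve 2 (λ q b → q :* (con 2 :* b) := (con 2 :* q) :* b) refl q b ⟩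
    (2 ℕ.* q) ℕ.* b                    ∎
    where
    open ℕ.≤-Reasoning
    k = rounds p

open import Data.Integer using (+_; +<+)
open import Data.Nat as ℕ using (ℕ; zero; suc; s≤s; z≤n)
import Data.Nat.Properties as ℕ
open import Data.Product using (Σ-syntax; ∃-syntax; _×_; _,_; proj₁; proj₂)
open import Data.Rational.Unnormalised using (ℚᵘ; mkℚᵘ; 0ℚᵘ; ½; _≤_; _<_; _-_; *<*)
open import Relation.Binary.PropositionalEquality using (refl; sym; cong)
open Complexity
open Complexity.Plan
open Assembly

theorem1 : Σ[ A ∈ Algorithm ] ∃[ c ] ∃[ d ] ∃[ C ] ∃[ C′ ]
    (∀ (n q : ℕ) (R : RDT n) (ε : ℚᵘ) →
    queryComplexity R ℕ.≤ q → 0ℚᵘ < ε → ε < ½ →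
    Σ[ D ∈ DDT n ] ∃[ t ]
    (A returns encode (tree D) on ⟪ encode R , encodeℚ ε ⟫ inTime t)
    × TimeBound c d C (descriptionLength R) q ε t
    × (queryComplexity (tree D) ≤ C′ · q ÷ ε)
    × (𝔼 (λ x → sq (⟦ D ⟧ᴰ x - 𝔼 (⟦ R ⟧ x))) ≤ ε))
theorem1 = algorithm 8 program , proj₁ main-guarantee , 4 , 10 , 2 , correct
  where
  correct : ∀ (n q : ℕ) (R : RDT n) (ε : ℚᵘ) → queryComplexity R ℕ.≤ q → 0ℚᵘ < ε → ε < ½ →
            Σ[ D ∈ DDT n ] ∃[ t ]
            (algorithm 8 program returns encode (tree D) on ⟪ encode R , encodeℚ ε ⟫ inTime t)
            × TimeBound (proj₁ main-guarantee) 4 10 (descriptionLength R) q ε t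
            × (queryComplexity (tree D) ≤ 2 · q ÷ ε)
            × (𝔼 (λ x → sq (⟦ D ⟧ᴰ x - 𝔼 (⟦ R ⟧ x))) ≤ ε)
  correct n q R (mkℚᵘ (+ zero) d) R≤q (*<* (+<+ ())) ε<½
  correct n q R ε@(mkℚᵘ (+ suc a) d) R≤q 0<ε ε<½ =
      output R p
    , time ℕ.+ size (encode (result R p))
    , (time , evaluation , refl)
    , (5 ℕ.* (rounds p ℕ.* queryComplexity R) , exponent , ℕ.≤-trans (ℕ.+-monoˡ-≤ _ time-≤) (proj₂ (proj₂ guarantee)))
    , product-≤ (queryComplexity (result R p)) (suc a) (2 ℕ.* q) d
        (ℕ.≤-trans (ℕ.*-monoˡ-≤ (suc a) (output-queries R p)) (total-queries R p q R≤q))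
    , output-error R p
    where
    p : Plan R (suc a) (suc d)
    p = plan R (suc a) (suc d) (s≤s z≤n) (numerator≤denominator (suc a) d ε<½)
    guarantee = proj₂ main-guarantee R p
    open Computes (proj₁ (proj₂ guarantee))
    -- The exponent 5Kq is one Kq for the number of leaves and four for the polynomial in K.
    exponent : (5 ℕ.* (rounds p ℕ.* queryComplexity R)) ≤ 10 · q ÷ ε
    exponent = product-≤ (5 ℕ.* (rounds p ℕ.* queryComplexity R)) (suc a) (10 ℕ.* q) d (begin
      5 ℕ.* kq ℕ.* suc a              ≡⟨ ℕ.*-assoc 5 kq (suc a) ⟩
      5 ℕ.* (kq ℕ.* suc a)            ≤⟨ ℕ.*-monoʳ-≤ 5 (total-queries R p q R≤q) ⟩
      5 ℕ.* ((2 ℕ.* q) ℕ.* suc d)     ≡⟨ sym (ℕ.*-assoc 5 (2 ℕ.* q) (suc d)) ⟩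
      5 ℕ.* (2 ℕ.* q) ℕ.* suc d       ≡⟨ cong (ℕ._* suc d) (sym (ℕ.*-assoc 5 2 q)) ⟩
      10 ℕ.* q ℕ.* suc d              ∎)
      where
      open ℕ.≤-Reasoning
      kq = rounds p ℕ.* queryComplexity R
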